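{- Let $n\ge 1$ and let $b=(b_1,\dots,b_n)$ be a sequence of positive integers. The $\mathbb{C}$-linear extension of $$A(b)\ni t^\pi\longmapsto t^{(\varphi(\pi),\,\deg\pi)}\in E(b),\qquad \pi\in\Pi(b),$$ is an isomorphism of graded algebras from the semigroup algebra $A(b)$ of L-S paths to the Ehrhart ring $E(b)$ of the lecture hall polytope $P(b)$.
   Context: For $b=(b_1,\dots,b_n)$ set $b_0=b_{n+1}:=1$. Let $e_1,\dots,e_{n+1}$ be the canonical basis of $\mathbb{R}^{n+1}$ and let $L(b)\subset\mathbb{R}^{n+1}$ be the lattice generated by $v_j:=\frac{e_j-e_{j+1}}{b_j}$ for $j=1,\dots,n$ and $v_{n+1}:=e_{n+1}$. The monoid of L-S paths with bonds $b$ is $\Pi(b):=L(b)\cap\mathbb{R}^{n+1}_{\ge 0}$. The degree of $\pi=(a_1,\dots,a_{n+1})\in\Pi(b)$ is $\deg(\pi):=a_1+\cdots+a_{n+1}$, a non-negative integer, and $\Pi(b)_k$ is the set of L-S paths of degree $k$. For $k=1,\dots,n+1$ let $N_k:=\mathrm{lcm}(b_k,b_{k-1})$, and let $R:=\mathbb{C}[t_1^{1/N_1},\dots,t_{n+1}^{1/N_{n+1}}]$ be the polynomial algebra in the indeterminates $t_k^{1/N_k}$. For $\pi=(a_1,\dots,a_{n+1})\in\Pi(b)$ one has $N_ka_k\in\mathbb{Z}_{\ge0}$ for all $k$, and $t^\pi:=t_1^{a_1}\cdots t_{n+1}^{a_{n+1}}\in R$. The semigroup algebra is $A(b):=\bigoplus_{\pi\in\Pi(b)}\mathbb{C}\,t^\pi\subseteq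 R$, with multiplication $t^\pi\cdot t^\eta=t^{\pi+\eta}$, graded by $A(b)_k:=\langle t^\pi\mid\pi\in\Pi(b)_k\rangle_{\mathbb{C}}$. The lecture hall polytope is $P(b):=\{(x_1,\dots,x_n)\in\mathbb{R}^n : 0\le\frac{x_1}{b_1}\le\cdots\le\frac{x_n}{b_n}\le 1\}$. For $p=(p_1,\dots,p_n)\in kP(b)\cap\mathbb{Z}^n$, $k\in\mathbb{Z}_{\ge 0}$, put $t^{(p,k)}:=t_1^{p_1}\cdots t_n^{p_n}t_{n+1}^k$. The Ehrhart ring of $P(b)$ is the graded algebra $E(b):=\bigoplus_{k\ge 0}E(b)_k$, $E(b)_k:=\langle t^{(p,k)}\mid p\in kP(b)\cap\mathbb{Z}^n\rangle_{\mathbb{C}}$, with multiplication $t^{(p,k)}\cdot t^{(q,h)}=t^{(p+q,k+h)}$. The map $\varphi:\mathbb{R}^{n+1}\to\mathbb{R}^n$ is the linear map $(a_1,\dots,a_{n+1})\mapsto(x_1,\dots,x_n)$ with $x_i=b_i(a_1+\cdots+a_i)$. -}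

module Defs where

open import Algebra.Bundles using (CommutativeMonoid; CommutativeRing; RawRing)
open import Algebra.Morphism.Structures using (module RingMorphisms)
import Algebra.Properties.Semiring.Sum as SemiringSum
open import Data.Bool.Base using (if_then_else_)
open import Data.Fin.Base using (Fin; zero; suc; fromℕ; inject; inject₁; Fin′)
import Data.Fin.Properties as Fin
open import Data.Fin.Relation.Unary.Top using (view; ‵fromℕ; ‵inject₁)
open import Data.Integer.Base as ℤ using (ℤ; +_)
import Data.Integer.Properties as ℤ
open import Data.List.Base as List
  using (List; []; _∷_; [_]; _++_; _∷ʳ_; tabulate; cartesianProductWith)
open import Data.List.Relation.Unary.All using (All)
open import Data.List.Relation.Unary.Linked using (Linked; [-]; _∷_)
open import Data.Nat.Base as ℕ using (ℕ; zero; suc; NonZero; _⊔_)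
import Data.Nat.Properties as ℕ
open import Data.Product.Base using (_×_; _,_; map₁; map₂; Σ-syntax; ∃-syntax)
open import Data.Rational.Base as ℚ using (ℚ; 0ℚ; 1ℚ; ½; ∣_∣)
import Data.Rational.Properties as ℚ
import Data.Rational.Unnormalised.Base as ℚᵘ
import Data.Rational.Unnormalised.Properties as ℚᵘ
open import Data.Sum.Base using (inj₁; inj₂)
open import Data.Vec.Functional using (Vector)
open import Function.Base using (_∘_)
open import Function.Bundles using (_⇔_)
open import Level using (0ℓ)
open import Relation.Binary.PropositionalEquality.Core as ≡ using (_≡_)
open import Relation.Nullary.Decidable.Core using (does; dec⇒maybe)
open import Relation.Unary using (Pred)
open import Tactic.RingSolver using (solve-∀)
open import Tactic.RingSolver.Core.AlmostCommutativeRing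
  using (AlmostCommutativeRing; fromCommutativeRing)

private
  ℚ-ring : AlmostCommutativeRing 0ℓ 0ℓ
  ℚ-ring = fromCommutativeRing ℚ.+-*-commutativeRing λ q → dec⇒maybe (0ℚ ℚ.≟ q)

------------------------------------------------------------------------
-- Real numbers: Cauchy sequences of rationals, compared by a setoid
-- equality.

IsCauchy : (ℕ → ℚ) → Set
IsCauchy s = ∀ ε → 0ℚ ℚ.< ε →
  ∃[ N ] ∀ {m n} → N ℕ.≤ m → N ℕ.≤ n → ∣ s m ℚ.- s n ∣ ℚ.< ε

record ℝ : Set where
  no-eta-equality
  field
    seq    : ℕ → ℚ
    cauchy : IsCauchy seq

open ℝ public

infix 4 _≈_ _≤_

-- Wrapped in records so that the two sides can be inferred.

record _≈_ (x y : ℝ) : Set where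
  constructor mk≈
  field
    close : ∀ ε → 0ℚ ℚ.< ε →
      ∃[ N ] ∀ {n} → N ℕ.≤ n → ∣ seq x n ℚ.- seq y n ∣ ℚ.< ε

record _≤_ (x y : ℝ) : Set where
  constructor mk≤
  field
    below : ∀ ε → 0ℚ ℚ.< ε →
      ∃[ N ] ∀ {n} → N ℕ.≤ n → seq x n ℚ.- seq y n ℚ.< ε

open _≈_ public
open _≤_ public

private
  half>0 : ∀ {ε} → 0ℚ ℚ.< ε → 0ℚ ℚ.< ½ ℚ.* ε
  half>0 {ε} ε>0 = ℚ.positive⁻¹ (½ ℚ.* ε) {{ℚ.pos*pos⇒pos ½ ε {{ℚ.positive ε>0}}}}

  half+half : ∀ ε → ½ ℚ.* ε ℚ.+ ½ ℚ.* ε ≡ ε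
  half+half ε = ≡.trans (≡.sym (ℚ.*-distribʳ-+ ε ½ ½)) (ℚ.*-identityˡ ε)

  <half : ∀ p q {ε} → p ℚ.< ½ ℚ.* ε → q ℚ.< ½ ℚ.* ε → p ℚ.+ q ℚ.< ε
  <half p q {ε} p< q< = ≡.subst (p ℚ.+ q ℚ.<_) (half+half ε) (ℚ.+-mono-< p< q<)

  -- δ with C * δ = ε
  quotient : ∀ C ε → 0ℚ ℚ.< C → 0ℚ ℚ.< ε → ∃[ δ ] 0ℚ ℚ.< δ × C ℚ.* δ ≡ ε
  quotient C ε C>0 ε>0 =
    1/C ℚ.* ε ,
    ℚ.positive⁻¹ (1/C ℚ.* ε) {{ℚ.pos*pos⇒pos 1/C {{ℚ.1/pos⇒pos C}} ε {{ℚ.positive ε>0}}}} ,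
    ≡.trans (≡.sym (ℚ.*-assoc C 1/C ε))
      (≡.trans (≡.cong (ℚ._* ε) (ℚ.*-inverseʳ C)) (ℚ.*-identityˡ ε))
    where
    instance
      _ = ℚ.positive C>0
      _ = ℚ.pos⇒nonZero C
    1/C = ℚ.1/ C

  ∣p-q∣≡∣q-p∣ : ∀ p q → ∣ p ℚ.- q ∣ ≡ ∣ q ℚ.- p ∣
  ∣p-q∣≡∣q-p∣ p q = ≡.trans (≡.sym (ℚ.∣-p∣≡∣p∣ (p ℚ.- q))) (≡.cong ∣_∣ (lemma p q))
    where
    lemma : ∀ p q → ℚ.- (p ℚ.- q) ≡ q ℚ.- p
    lemma = solve-∀ ℚ-ring

  p≤∣p∣ : ∀ p → p ℚ.≤ ∣ p ∣
  p≤∣p∣ p with ℚ.≤-total 0ℚ p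
  ... | inj₁ 0≤p = ℚ.≤-reflexive (≡.sym (ℚ.0≤p⇒∣p∣≡p 0≤p))
  ... | inj₂ p≤0 = ℚ.≤-trans p≤0 (ℚ.0≤∣p∣ p)

  close-+ : ∀ a a′ b b′ {ε} → ∣ a ℚ.- a′ ∣ ℚ.< ½ ℚ.* ε → ∣ b ℚ.- b′ ∣ ℚ.< ½ ℚ.* ε →
            ∣ (a ℚ.+ b) ℚ.- (a′ ℚ.+ b′) ∣ ℚ.< ε
  close-+ a a′ b b′ {ε} a~a′ b~b′ = begin-strict
    ∣ (a ℚ.+ b) ℚ.- (a′ ℚ.+ b′) ∣    ≡⟨ ≡.cong ∣_∣ (lemma a a′ b b′) ⟩
    ∣ (a ℚ.- a′) ℚ.+ (b ℚ.- b′) ∣    ≤⟨ ℚ.∣p+q∣≤∣p∣+∣q∣ (a ℚ.- a′) (b ℚ.- b′) ⟩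
    ∣ a ℚ.- a′ ∣ ℚ.+ ∣ b ℚ.- b′ ∣    <⟨ <half ∣ a ℚ.- a′ ∣ ∣ b ℚ.- b′ ∣ a~a′ b~b′ ⟩
    ε                                ∎
    where
    open ℚ.≤-Reasoning
    lemma : ∀ a a′ b b′ → (a ℚ.+ b) ℚ.- (a′ ℚ.+ b′) ≡ (a ℚ.- a′) ℚ.+ (b ℚ.- b′)
    lemma = solve-∀ ℚ-ring

  close-- : ∀ a a′ {ε} → ∣ a ℚ.- a′ ∣ ℚ.< ε → ∣ (ℚ.- a) ℚ.- (ℚ.- a′) ∣ ℚ.< ε
  close-- a a′ {ε} = ≡.subst (ℚ._< ε)
    (≡.trans (≡.sym (ℚ.∣-p∣≡∣p∣ (a ℚ.- a′))) (≡.cong ∣_∣ (lemma a a′)))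
    where
    lemma : ∀ a a′ → ℚ.- (a ℚ.- a′) ≡ (ℚ.- a) ℚ.- (ℚ.- a′)
    lemma = solve-∀ ℚ-ring

  close-* : ∀ a a′ b b′ {A B δ} → ∣ a ∣ ℚ.< A → ∣ b′ ∣ ℚ.< B → 0ℚ ℚ.< A → 0ℚ ℚ.< B →
            ∣ a ℚ.- a′ ∣ ℚ.< δ → ∣ b ℚ.- b′ ∣ ℚ.< δ →
            ∣ a ℚ.* b ℚ.- a′ ℚ.* b′ ∣ ℚ.< (A ℚ.+ B) ℚ.* δ
  close-* a a′ b b′ {A} {B} {δ} a<A b′<B A>0 B>0 a~a′ b~b′ = begin-strict
    ∣ a ℚ.* b ℚ.- a′ ℚ.* b′ ∣
      ≡⟨ ≡.cong ∣_∣ (lemma a a′ b b′) ⟩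
    ∣ a ℚ.* (b ℚ.- b′) ℚ.+ b′ ℚ.* (a ℚ.- a′) ∣
      ≤⟨ ℚ.∣p+q∣≤∣p∣+∣q∣ (a ℚ.* (b ℚ.- b′)) (b′ ℚ.* (a ℚ.- a′)) ⟩
    ∣ a ℚ.* (b ℚ.- b′) ∣ ℚ.+ ∣ b′ ℚ.* (a ℚ.- a′) ∣
      <⟨ ℚ.+-mono-< (bound a (b ℚ.- b′) a<A A>0 b~b′) (bound b′ (a ℚ.- a′) b′<B B>0 a~a′) ⟩
    A ℚ.* δ ℚ.+ B ℚ.* δ
      ≡⟨ ≡.sym (ℚ.*-distribʳ-+ δ A B) ⟩
    (A ℚ.+ B) ℚ.* δ ∎
    where
    open ℚ.≤-Reasoning
    lemma : ∀ a a′ b b′ →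
      a ℚ.* b ℚ.- a′ ℚ.* b′ ≡ a ℚ.* (b ℚ.- b′) ℚ.+ b′ ℚ.* (a ℚ.- a′)
    lemma = solve-∀ ℚ-ring
    bound : ∀ p q {C} → ∣ p ∣ ℚ.< C → 0ℚ ℚ.< C → ∣ q ∣ ℚ.< δ → ∣ p ℚ.* q ∣ ℚ.< C ℚ.* δ
    bound p q {C} p<C C>0 q<δ = begin-strict
      ∣ p ℚ.* q ∣       ≡⟨ ℚ.∣p*q∣≡∣p∣*∣q∣ p q ⟩
      ∣ p ∣ ℚ.* ∣ q ∣   ≤⟨ ℚ.*-monoʳ-≤-nonNeg ∣ q ∣ {{ℚ.∣-∣-nonNeg q}} (ℚ.<⇒≤ p<C) ⟩
      C ℚ.* ∣ q ∣       <⟨ ℚ.*-monoʳ-<-pos C {{ℚ.positive C>0}} q<δ ⟩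
      C ℚ.* δ           ∎

  bounded : ∀ x → ∃[ A ] 0ℚ ℚ.< A × ∃[ N ] ∀ {n} → N ℕ.≤ n → ∣ seq x n ∣ ℚ.< A
  bounded x with cauchy x 1ℚ (ℚ.positive⁻¹ 1ℚ)
  ... | N , close = 1ℚ ℚ.+ ∣ xN ∣ ,
        ℚ.+-mono-<-≤ (ℚ.positive⁻¹ 1ℚ) (ℚ.0≤∣p∣ xN) , N , λ {n} N≤n → begin-strict
    ∣ seq x n ∣                      ≡⟨ ≡.cong ∣_∣ (lemma (seq x n) xN) ⟩
    ∣ (seq x n ℚ.- xN) ℚ.+ xN ∣      ≤⟨ ℚ.∣p+q∣≤∣p∣+∣q∣ (seq x n ℚ.- xN) xN ⟩
    ∣ seq x n ℚ.- xN ∣ ℚ.+ ∣ xN ∣    <⟨ ℚ.+-monoˡ-< ∣ xN ∣ (close N≤n ℕ.≤-refl) ⟩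
    1ℚ ℚ.+ ∣ xN ∣                    ∎
    where
    open ℚ.≤-Reasoning
    xN = seq x N
    lemma : ∀ p q → p ≡ (p ℚ.- q) ℚ.+ q
    lemma = solve-∀ ℚ-ring

infixl 6 _+_ _-_
infixl 7 _*_
infix  8 -_

_+_ : ℝ → ℝ → ℝ
seq    (x + y) n = seq x n ℚ.+ seq y n
cauchy (x + y) ε ε>0 =
  let N₁ , p = cauchy x (½ ℚ.* ε) (half>0 ε>0)
      N₂ , q = cauchy y (½ ℚ.* ε) (half>0 ε>0)
  in N₁ ⊔ N₂ , λ {m} {n} m≥ n≥ → close-+ (seq x m) (seq x n) (seq y m) (seq y n)
       (p (ℕ.m⊔n≤o⇒m≤o N₁ N₂ m≥) (ℕ.m⊔n≤o⇒m≤o N₁ N₂ n≥))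
       (q (ℕ.m⊔n≤o⇒n≤o N₁ N₂ m≥) (ℕ.m⊔n≤o⇒n≤o N₁ N₂ n≥))

-_ : ℝ → ℝ
seq    (- x) n = ℚ.- seq x n
cauchy (- x) ε ε>0 = map₂
  (λ p {m} {n} m≥ n≥ → close-- (seq x m) (seq x n) (p m≥ n≥)) (cauchy x ε ε>0)

_-_ : ℝ → ℝ → ℝ
x - y = x + - y

_*_ : ℝ → ℝ → ℝ
seq    (x * y) n = seq x n ℚ.* seq y n
cauchy (x * y) ε ε>0 =
  let A , A>0 , N₁ , x<A = bounded x
      B , B>0 , N₂ , y<B = bounded y
      δ , δ>0 , eq = quotient (A ℚ.+ B) ε (ℚ.+-mono-< A>0 B>0) ε>0
      N₃ , p = cauchy x δ δ>0
      N₄ , q = cauchy y δ δ>0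
      N = (N₁ ⊔ N₂) ⊔ (N₃ ⊔ N₄)
      l : ∀ {n} → N ℕ.≤ n → N₁ ⊔ N₂ ℕ.≤ n
      l = ℕ.m⊔n≤o⇒m≤o (N₁ ⊔ N₂) (N₃ ⊔ N₄)
      r : ∀ {n} → N ℕ.≤ n → N₃ ⊔ N₄ ℕ.≤ n
      r = ℕ.m⊔n≤o⇒n≤o (N₁ ⊔ N₂) (N₃ ⊔ N₄)
  in N , λ {m} {n} m≥ n≥ →
       ≡.subst (∣ seq x m ℚ.* seq y m ℚ.- seq x n ℚ.* seq y n ∣ ℚ.<_) eq
       (close-* (seq x m) (seq x n) (seq y m) (seq y n)
       (x<A (ℕ.m⊔n≤o⇒m≤o N₁ N₂ (l m≥))) (y<B (ℕ.m⊔n≤o⇒n≤o N₁ N₂ (l n≥))) A>0 B>0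
       (p (ℕ.m⊔n≤o⇒m≤o N₃ N₄ (r m≥)) (ℕ.m⊔n≤o⇒m≤o N₃ N₄ (r n≥)))
       (q (ℕ.m⊔n≤o⇒n≤o N₃ N₄ (r m≥)) (ℕ.m⊔n≤o⇒n≤o N₃ N₄ (r n≥))))

fromℚ : ℚ → ℝ
seq    (fromℚ q) _ = q
cauchy (fromℚ q) ε ε>0 = 0 , λ _ _ →
  ≡.subst (ℚ._< ε) (≡.sym (≡.cong ∣_∣ (ℚ.+-inverseʳ q))) ε>0

fromℤ : ℤ → ℝ
fromℤ i = fromℚ (i ℚ./ 1)

infixl 7 _/_

_/_ : ℝ → (d : ℕ) → .{{NonZero d}} → ℝ
x / d = fromℚ (+ 1 ℚ./ d) * x

0ℝ 1ℝ : ℝ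
0ℝ = fromℚ 0ℚ
1ℝ = fromℚ 1ℚ

pointwise : ∀ {x y} → (∀ n → seq x n ≡ seq y n) → x ≈ y
pointwise {x} {y} eq = mk≈ λ ε ε>0 → 0 , λ {n} _ →
  ≡.subst (ℚ._< ε) (≡.sym (≡.cong ∣_∣
    (≡.trans (≡.cong (ℚ._- seq y n) (eq n)) (ℚ.+-inverseʳ (seq y n))))) ε>0

private
  ≈-sym : ∀ {x y} → x ≈ y → y ≈ x
  ≈-sym {x} {y} p = mk≈ λ ε ε>0 → map₂
    (λ q {n} n≥ → ≡.subst (ℚ._< ε) (∣p-q∣≡∣q-p∣ (seq x n) (seq y n)) (q n≥)) (close p ε ε>0)

  ≈-trans : ∀ {x y z} → x ≈ y → y ≈ z → x ≈ z
  ≈-trans {x} {y} {z} p q = mk≈ λ ε ε>0 →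
    let N₁ , r = close p (½ ℚ.* ε) (half>0 ε>0)
        N₂ , s = close q (½ ℚ.* ε) (half>0 ε>0)
    in N₁ ⊔ N₂ , λ {n} n≥ → ≡.subst (ℚ._< ε) (≡.cong ∣_∣ (lemma (seq x n) (seq y n) (seq z n)))
         (close-+ (seq x n) (seq y n) (seq y n) (seq z n)
           (r (ℕ.m⊔n≤o⇒m≤o N₁ N₂ n≥)) (s (ℕ.m⊔n≤o⇒n≤o N₁ N₂ n≥)))
    where
    lemma : ∀ a b c → (a ℚ.+ b) ℚ.- (b ℚ.+ c) ≡ a ℚ.- c
    lemma = solve-∀ ℚ-ring

  +-cong : ∀ {x x′ y y′} → x ≈ x′ → y ≈ y′ → x + y ≈ x′ + y′
  +-cong {x} {x′} {y} {y′} p q = mk≈ λ ε ε>0 →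
    let N₁ , r = close p (½ ℚ.* ε) (half>0 ε>0)
        N₂ , s = close q (½ ℚ.* ε) (half>0 ε>0)
    in N₁ ⊔ N₂ , λ {n} n≥ → close-+ (seq x n) (seq x′ n) (seq y n) (seq y′ n)
         (r (ℕ.m⊔n≤o⇒m≤o N₁ N₂ n≥)) (s (ℕ.m⊔n≤o⇒n≤o N₁ N₂ n≥))

  -‿cong : ∀ {x x′} → x ≈ x′ → - x ≈ - x′
  -‿cong {x} {x′} p = mk≈ λ ε ε>0 → map₂
    (λ q {n} n≥ → close-- (seq x n) (seq x′ n) (q n≥)) (close p ε ε>0)

  *-cong : ∀ {x x′ y y′} → x ≈ x′ → y ≈ y′ → x * y ≈ x′ * y′
  *-cong {x} {x′} {y} {y′} x≈x′ y≈y′ = mk≈ λ ε ε>0 →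
    let A , A>0 , N₁ , x<A  = bounded x
        B , B>0 , N₂ , y′<B = bounded y′
        δ , δ>0 , eq = quotient (A ℚ.+ B) ε (ℚ.+-mono-< A>0 B>0) ε>0
        N₃ , p = close x≈x′ δ δ>0
        N₄ , q = close y≈y′ δ δ>0
        N = (N₁ ⊔ N₂) ⊔ (N₃ ⊔ N₄)
        l : ∀ {n} → N ℕ.≤ n → N₁ ⊔ N₂ ℕ.≤ n
        l = ℕ.m⊔n≤o⇒m≤o (N₁ ⊔ N₂) (N₃ ⊔ N₄)
        r : ∀ {n} → N ℕ.≤ n → N₃ ⊔ N₄ ℕ.≤ n
        r = ℕ.m⊔n≤o⇒n≤o (N₁ ⊔ N₂) (N₃ ⊔ N₄)
    in N , λ {n} n≥ →
         ≡.subst (∣ seq x n ℚ.* seq y n ℚ.- seq x′ n ℚ.* seq y′ n ∣ ℚ.<_) eq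
         (close-* (seq x n) (seq x′ n) (seq y n) (seq y′ n)
         (x<A (ℕ.m⊔n≤o⇒m≤o N₁ N₂ (l n≥))) (y′<B (ℕ.m⊔n≤o⇒n≤o N₁ N₂ (l n≥))) A>0 B>0
         (p (ℕ.m⊔n≤o⇒m≤o N₃ N₄ (r n≥))) (q (ℕ.m⊔n≤o⇒n≤o N₃ N₄ (r n≥))))

  ≈-refl : ∀ {x} → x ≈ x
  ≈-refl = pointwise λ _ → ≡.refl

  +-assoc : ∀ x y z → (x + y) + z ≈ x + (y + z)
  +-assoc x y z = pointwise λ n → ℚ.+-assoc (seq x n) (seq y n) (seq z n)

  +-comm : ∀ x y → x + y ≈ y + x
  +-comm x y = pointwise λ n → ℚ.+-comm (seq x n) (seq y n)

  +-identityˡ : ∀ x → 0ℝ + x ≈ x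
  +-identityˡ x = pointwise λ n → ℚ.+-identityˡ (seq x n)

  +-identityʳ : ∀ x → x + 0ℝ ≈ x
  +-identityʳ x = pointwise λ n → ℚ.+-identityʳ (seq x n)

  -‿inverseˡ : ∀ x → - x + x ≈ 0ℝ
  -‿inverseˡ x = pointwise λ n → ℚ.+-inverseˡ (seq x n)

  -‿inverseʳ : ∀ x → x + - x ≈ 0ℝ
  -‿inverseʳ x = pointwise λ n → ℚ.+-inverseʳ (seq x n)

  *-assoc : ∀ x y z → (x * y) * z ≈ x * (y * z)
  *-assoc x y z = pointwise λ n → ℚ.*-assoc (seq x n) (seq y n) (seq z n)

  *-comm : ∀ x y → x * y ≈ y * x
  *-comm x y = pointwise λ n → ℚ.*-comm (seq x n) (seq y n)

  *-identityˡ : ∀ x → 1ℝ * x ≈ x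
  *-identityˡ x = pointwise λ n → ℚ.*-identityˡ (seq x n)

  *-identityʳ : ∀ x → x * 1ℝ ≈ x
  *-identityʳ x = pointwise λ n → ℚ.*-identityʳ (seq x n)

  distribˡ : ∀ x y z → x * (y + z) ≈ x * y + x * z
  distribˡ x y z = pointwise λ n → ℚ.*-distribˡ-+ (seq x n) (seq y n) (seq z n)

  distribʳ : ∀ x y z → (y + z) * x ≈ y * x + z * x
  distribʳ x y z = pointwise λ n → ℚ.*-distribʳ-+ (seq x n) (seq y n) (seq z n)

ℝ-commutativeRing : CommutativeRing 0ℓ 0ℓ
ℝ-commutativeRing = record
  { Carrier = ℝ ; _≈_ = _≈_ ; _+_ = _+_ ; _*_ = _*_ ; -_ = -_ ; 0# = 0ℝ ; 1# = 1ℝ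
  ; isCommutativeRing = record
    { isRing = record
      { +-isAbelianGroup = record
        { isGroup = record
          { isMonoid = record
            { isSemigroup = record
              { isMagma = record
                { isEquivalence = record { refl = ≈-refl ; sym = ≈-sym ; trans = ≈-trans }
                ; ∙-cong = +-cong }
              ; assoc = +-assoc }
            ; identity = +-identityˡ , +-identityʳ }
          ; inverse = -‿inverseˡ , -‿inverseʳ
          ; ⁻¹-cong = -‿cong }
        ; comm = +-comm }
      ; *-cong = *-cong
      ; *-assoc = *-assoc
      ; *-identity = *-identityˡ , *-identityʳ
      ; distrib = distribˡ , distribʳ }
    ; *-comm = *-comm } }

private
  module Real = CommutativeRing ℝ-commutativeRing
  module Sum = SemiringSum Real.semiring

open Sum using (sum) public

≈⇒≤ : ∀ {x y} → x ≈ y → x ≤ y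
≈⇒≤ {x} {y} p = mk≤ λ ε ε>0 → map₂
  (λ q {n} n≥ → ℚ.≤-<-trans (p≤∣p∣ (seq x n ℚ.- seq y n)) (q n≥)) (close p ε ε>0)

fromℚ-mono : ∀ {p q} → p ℚ.≤ q → fromℚ p ≤ fromℚ q
fromℚ-mono {p} {q} p≤q = mk≤ λ ε ε>0 → 0 , λ _ →
  ℚ.≤-<-trans (≡.subst (p ℚ.- q ℚ.≤_) (ℚ.+-inverseʳ q) (ℚ.+-monoˡ-≤ (ℚ.- q) p≤q)) ε>0

≤-trans : ∀ {x y z} → x ≤ y → y ≤ z → x ≤ z
≤-trans {x} {y} {z} p q = mk≤ λ ε ε>0 →
  let N₁ , r = below p (½ ℚ.* ε) (half>0 ε>0)
      N₂ , s = below q (½ ℚ.* ε) (half>0 ε>0)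
  in N₁ ⊔ N₂ , λ {n} n≥ → ≡.subst (ℚ._< ε) (lemma (seq x n) (seq y n) (seq z n))
       (<half (seq x n ℚ.- seq y n) (seq y n ℚ.- seq z n)
         (r (ℕ.m⊔n≤o⇒m≤o N₁ N₂ n≥)) (s (ℕ.m⊔n≤o⇒n≤o N₁ N₂ n≥)))
  where
  lemma : ∀ a b c → (a ℚ.- b) ℚ.+ (b ℚ.- c) ≡ a ℚ.- c
  lemma = solve-∀ ℚ-ring

+-mono-≤ : ∀ {x x′ y y′} → x ≤ x′ → y ≤ y′ → x + y ≤ x′ + y′
+-mono-≤ {x} {x′} {y} {y′} p q = mk≤ λ ε ε>0 →
  let N₁ , r = below p (½ ℚ.* ε) (half>0 ε>0)
      N₂ , s = below q (½ ℚ.* ε) (half>0 ε>0)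
  in N₁ ⊔ N₂ , λ {n} n≥ →
       ≡.subst (ℚ._< ε) (lemma (seq x n) (seq x′ n) (seq y n) (seq y′ n))
       (<half (seq x n ℚ.- seq x′ n) (seq y n ℚ.- seq y′ n)
         (r (ℕ.m⊔n≤o⇒m≤o N₁ N₂ n≥)) (s (ℕ.m⊔n≤o⇒n≤o N₁ N₂ n≥)))
  where
  lemma : ∀ a b c d → (a ℚ.- b) ℚ.+ (c ℚ.- d) ≡ (a ℚ.+ c) ℚ.- (b ℚ.+ d)
  lemma = solve-∀ ℚ-ring

*-mono-≤ : ∀ q {x y} → 0ℚ ℚ.≤ q → x ≤ y → fromℚ q * x ≤ fromℚ q * y
*-mono-≤ q {x} {y} q≥0 p = mk≤ λ ε ε>0 →
  let δ , δ>0 , eq = quotient (1ℚ ℚ.+ q) ε (ℚ.+-mono-<-≤ (ℚ.positive⁻¹ 1ℚ) q≥0) ε>0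
      N , r = below p δ δ>0
  in N , λ {n} n≥ → begin-strict
       q ℚ.* seq x n ℚ.- q ℚ.* seq y n  ≡⟨ lemma q (seq x n) (seq y n) ⟩
       q ℚ.* (seq x n ℚ.- seq y n)      ≤⟨ ℚ.*-monoˡ-≤-nonNeg q {{ℚ.nonNegative q≥0}} (ℚ.<⇒≤ (r n≥)) ⟩
       q ℚ.* δ                          ≡⟨ ≡.sym (ℚ.+-identityʳ (q ℚ.* δ)) ⟩
       q ℚ.* δ ℚ.+ 0ℚ                   <⟨ ℚ.+-monoʳ-< (q ℚ.* δ) δ>0 ⟩
       q ℚ.* δ ℚ.+ δ                    ≡⟨ lemma′ q δ ⟩
       (1ℚ ℚ.+ q) ℚ.* δ                 ≡⟨ eq ⟩
       ε                                ∎
  where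
  open ℚ.≤-Reasoning
  lemma : ∀ q a b → q ℚ.* a ℚ.- q ℚ.* b ≡ q ℚ.* (a ℚ.- b)
  lemma = solve-∀ ℚ-ring
  lemma′ : ∀ q d → q ℚ.* d ℚ.+ d ≡ (1ℚ ℚ.+ q) ℚ.* d
  lemma′ = solve-∀ ℚ-ring

/1-homo-+ : ∀ i j → (i ℤ.+ j) ℚ./ 1 ≡ i ℚ./ 1 ℚ.+ j ℚ./ 1
/1-homo-+ i j = ℚ.toℚᵘ-injective (ℚᵘ.≃-trans
  (ℚ.toℚᵘ-fromℚᵘ (ℚᵘ.mkℚᵘ (i ℤ.+ j) 0))
  (ℚᵘ.≃-trans
    (ℚᵘ.*≡* (≡.cong (ℤ._* ℤ.1ℤ) (≡.cong₂ ℤ._+_ (≡.sym (ℤ.*-identityʳ i)) (≡.sym (ℤ.*-identityʳ j)))))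
    (ℚᵘ.≃-sym (ℚᵘ.≃-trans (ℚ.toℚᵘ-homo-+ (i ℚ./ 1) (j ℚ./ 1))
      (ℚᵘ.+-cong (ℚ.toℚᵘ-fromℚᵘ (ℚᵘ.mkℚᵘ i 0)) (ℚ.toℚᵘ-fromℚᵘ (ℚᵘ.mkℚᵘ j 0)))))))

fromℤ-+ : ∀ i j → fromℤ (i ℤ.+ j) ≈ fromℤ i + fromℤ j
fromℤ-+ i j = pointwise λ _ → /1-homo-+ i j

------------------------------------------------------------------------
-- Complex numbers

record ℂ : Set where
  no-eta-equality
  field
    re im : ℝ

open ℂ public

infix 4 _≈ᶜ_

record _≈ᶜ_ (z w : ℂ) : Set where
  constructor mk≈ᶜ
  field
    re≈ : re z ≈ re w
    im≈ : im z ≈ im w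

open _≈ᶜ_ public

infixl 6 _+ᶜ_
infixl 7 _*ᶜ_
infix  8 -ᶜ_

_+ᶜ_ _*ᶜ_ : ℂ → ℂ → ℂ
re (z +ᶜ w) = re z + re w
im (z +ᶜ w) = im z + im w
re (z *ᶜ w) = re z * re w - im z * im w
im (z *ᶜ w) = re z * im w + im z * re w

-ᶜ_ : ℂ → ℂ
re (-ᶜ z) = - re z
im (-ᶜ z) = - im z

0ᶜ 1ᶜ : ℂ
re 0ᶜ = 0ℝ
im 0ᶜ = 0ℝ
re 1ᶜ = 1ℝ
im 1ᶜ = 0ℝ

private
  ≈ᶜ-refl : ∀ {x} → x ≈ᶜ x
  ≈ᶜ-refl = mk≈ᶜ ≈-refl ≈-refl

  ≈ᶜ-sym : ∀ {x y} → x ≈ᶜ y → y ≈ᶜ x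
  ≈ᶜ-sym p = mk≈ᶜ (≈-sym (re≈ p)) (≈-sym (im≈ p))

  ≈ᶜ-trans : ∀ {x y z} → x ≈ᶜ y → y ≈ᶜ z → x ≈ᶜ z
  ≈ᶜ-trans p q = mk≈ᶜ (≈-trans (re≈ p) (re≈ q)) (≈-trans (im≈ p) (im≈ q))

  +ᶜ-cong : ∀ {x x′ y y′} → x ≈ᶜ x′ → y ≈ᶜ y′ → x +ᶜ y ≈ᶜ x′ +ᶜ y′
  +ᶜ-cong p q = mk≈ᶜ (+-cong (re≈ p) (re≈ q)) (+-cong (im≈ p) (im≈ q))

  -ᶜ-cong : ∀ {x x′} → x ≈ᶜ x′ → -ᶜ x ≈ᶜ -ᶜ x′
  -ᶜ-cong p = mk≈ᶜ (-‿cong (re≈ p)) (-‿cong (im≈ p))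

  *ᶜ-cong : ∀ {x x′ y y′} → x ≈ᶜ x′ → y ≈ᶜ y′ → x *ᶜ y ≈ᶜ x′ *ᶜ y′
  *ᶜ-cong p q = mk≈ᶜ
    (+-cong (*-cong (re≈ p) (re≈ q)) (-‿cong (*-cong (im≈ p) (im≈ q))))
    (+-cong (*-cong (re≈ p) (im≈ q)) (*-cong (im≈ p) (re≈ q)))

  +ᶜ-assoc : ∀ x y z → (x +ᶜ y) +ᶜ z ≈ᶜ x +ᶜ (y +ᶜ z)
  +ᶜ-assoc x y z = mk≈ᶜ (+-assoc (re x) (re y) (re z)) (+-assoc (im x) (im y) (im z))

  +ᶜ-comm : ∀ x y → x +ᶜ y ≈ᶜ y +ᶜ x
  +ᶜ-comm x y = mk≈ᶜ (+-comm (re x) (re y)) (+-comm (im x) (im y))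

  +ᶜ-identityˡ : ∀ x → 0ᶜ +ᶜ x ≈ᶜ x
  +ᶜ-identityˡ x = mk≈ᶜ (+-identityˡ (re x)) (+-identityˡ (im x))

  +ᶜ-identityʳ : ∀ x → x +ᶜ 0ᶜ ≈ᶜ x
  +ᶜ-identityʳ x = mk≈ᶜ (+-identityʳ (re x)) (+-identityʳ (im x))

  -ᶜ-inverseˡ : ∀ x → -ᶜ x +ᶜ x ≈ᶜ 0ᶜ
  -ᶜ-inverseˡ x = mk≈ᶜ (-‿inverseˡ (re x)) (-‿inverseˡ (im x))

  -ᶜ-inverseʳ : ∀ x → x +ᶜ -ᶜ x ≈ᶜ 0ᶜ
  -ᶜ-inverseʳ x = mk≈ᶜ (-‿inverseʳ (re x)) (-‿inverseʳ (im x))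

  *ᶜ-assoc : ∀ x y z → (x *ᶜ y) *ᶜ z ≈ᶜ x *ᶜ (y *ᶜ z)
  *ᶜ-assoc x y z = mk≈ᶜ
    (pointwise λ n → assoc-re (seq (re x) n) (seq (im x) n)
      (seq (re y) n) (seq (im y) n) (seq (re z) n) (seq (im z) n))
    (pointwise λ n → assoc-im (seq (re x) n) (seq (im x) n)
      (seq (re y) n) (seq (im y) n) (seq (re z) n) (seq (im z) n))
    where
    assoc-re : ∀ a a′ b b′ c c′ →
      (a ℚ.* b ℚ.- a′ ℚ.* b′) ℚ.* c ℚ.- (a ℚ.* b′ ℚ.+ a′ ℚ.* b) ℚ.* c′ ≡
      a ℚ.* (b ℚ.* c ℚ.- b′ ℚ.* c′) ℚ.- a′ ℚ.* (b ℚ.* c′ ℚ.+ b′ ℚ.* c)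
    assoc-re = solve-∀ ℚ-ring
    assoc-im : ∀ a a′ b b′ c c′ →
      (a ℚ.* b ℚ.- a′ ℚ.* b′) ℚ.* c′ ℚ.+ (a ℚ.* b′ ℚ.+ a′ ℚ.* b) ℚ.* c ≡
      a ℚ.* (b ℚ.* c′ ℚ.+ b′ ℚ.* c) ℚ.+ a′ ℚ.* (b ℚ.* c ℚ.- b′ ℚ.* c′)
    assoc-im = solve-∀ ℚ-ring

  *ᶜ-comm : ∀ x y → x *ᶜ y ≈ᶜ y *ᶜ x
  *ᶜ-comm x y = mk≈ᶜ
    (pointwise λ n → comm-re (seq (re x) n) (seq (im x) n) (seq (re y) n) (seq (im y) n))
    (pointwise λ n → comm-im (seq (re x) n) (seq (im x) n) (seq (re y) n) (seq (im y) n))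
    where
    comm-re : ∀ a a′ b b′ → a ℚ.* b ℚ.- a′ ℚ.* b′ ≡ b ℚ.* a ℚ.- b′ ℚ.* a′
    comm-re = solve-∀ ℚ-ring
    comm-im : ∀ a a′ b b′ → a ℚ.* b′ ℚ.+ a′ ℚ.* b ≡ b ℚ.* a′ ℚ.+ b′ ℚ.* a
    comm-im = solve-∀ ℚ-ring

  *ᶜ-identityˡ : ∀ x → 1ᶜ *ᶜ x ≈ᶜ x
  *ᶜ-identityˡ x = mk≈ᶜ
    (pointwise λ n → idˡ-re (seq (re x) n) (seq (im x) n))
    (pointwise λ n → idˡ-im (seq (re x) n) (seq (im x) n))
    where
    idˡ-re : ∀ a a′ → 1ℚ ℚ.* a ℚ.- 0ℚ ℚ.* a′ ≡ a
    idˡ-re = solve-∀ ℚ-ring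
    idˡ-im : ∀ a a′ → 1ℚ ℚ.* a′ ℚ.+ 0ℚ ℚ.* a ≡ a′
    idˡ-im = solve-∀ ℚ-ring

  *ᶜ-identityʳ : ∀ x → x *ᶜ 1ᶜ ≈ᶜ x
  *ᶜ-identityʳ x = mk≈ᶜ
    (pointwise λ n → idʳ-re (seq (re x) n) (seq (im x) n))
    (pointwise λ n → idʳ-im (seq (re x) n) (seq (im x) n))
    where
    idʳ-re : ∀ a a′ → a ℚ.* 1ℚ ℚ.- a′ ℚ.* 0ℚ ≡ a
    idʳ-re = solve-∀ ℚ-ring
    idʳ-im : ∀ a a′ → a ℚ.* 0ℚ ℚ.+ a′ ℚ.* 1ℚ ≡ a′
    idʳ-im = solve-∀ ℚ-ring

  distribˡᶜ : ∀ x y z → x *ᶜ (y +ᶜ z) ≈ᶜ x *ᶜ y +ᶜ x *ᶜ z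
  distribˡᶜ x y z = mk≈ᶜ
    (pointwise λ n → distˡ-re (seq (re x) n) (seq (im x) n)
      (seq (re y) n) (seq (im y) n) (seq (re z) n) (seq (im z) n))
    (pointwise λ n → distˡ-im (seq (re x) n) (seq (im x) n)
      (seq (re y) n) (seq (im y) n) (seq (re z) n) (seq (im z) n))
    where
    distˡ-re : ∀ a a′ b b′ c c′ →
      a ℚ.* (b ℚ.+ c) ℚ.- a′ ℚ.* (b′ ℚ.+ c′) ≡
      (a ℚ.* b ℚ.- a′ ℚ.* b′) ℚ.+ (a ℚ.* c ℚ.- a′ ℚ.* c′)
    distˡ-re = solve-∀ ℚ-ring
    distˡ-im : ∀ a a′ b b′ c c′ →
      a ℚ.* (b′ ℚ.+ c′) ℚ.+ a′ ℚ.* (b ℚ.+ c) ≡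
      (a ℚ.* b′ ℚ.+ a′ ℚ.* b) ℚ.+ (a ℚ.* c′ ℚ.+ a′ ℚ.* c)
    distˡ-im = solve-∀ ℚ-ring

  distribʳᶜ : ∀ x y z → (y +ᶜ z) *ᶜ x ≈ᶜ y *ᶜ x +ᶜ z *ᶜ x
  distribʳᶜ x y z = mk≈ᶜ
    (pointwise λ n → distʳ-re (seq (re x) n) (seq (im x) n)
      (seq (re y) n) (seq (im y) n) (seq (re z) n) (seq (im z) n))
    (pointwise λ n → distʳ-im (seq (re x) n) (seq (im x) n)
      (seq (re y) n) (seq (im y) n) (seq (re z) n) (seq (im z) n))
    where
    distʳ-re : ∀ a a′ b b′ c c′ →
      (b ℚ.+ c) ℚ.* a ℚ.- (b′ ℚ.+ c′) ℚ.* a′ ≡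
      (b ℚ.* a ℚ.- b′ ℚ.* a′) ℚ.+ (c ℚ.* a ℚ.- c′ ℚ.* a′)
    distʳ-re = solve-∀ ℚ-ring
    distʳ-im : ∀ a a′ b b′ c c′ →
      (b ℚ.+ c) ℚ.* a′ ℚ.+ (b′ ℚ.+ c′) ℚ.* a ≡
      (b ℚ.* a′ ℚ.+ b′ ℚ.* a) ℚ.+ (c ℚ.* a′ ℚ.+ c′ ℚ.* a)
    distʳ-im = solve-∀ ℚ-ring

ℂ-commutativeRing : CommutativeRing 0ℓ 0ℓ
ℂ-commutativeRing = record
  { Carrier = ℂ ; _≈_ = _≈ᶜ_ ; _+_ = _+ᶜ_ ; _*_ = _*ᶜ_ ; -_ = -ᶜ_ ; 0# = 0ᶜ ; 1# = 1ᶜ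
  ; isCommutativeRing = record
    { isRing = record
      { +-isAbelianGroup = record
        { isGroup = record
          { isMonoid = record
            { isSemigroup = record
              { isMagma = record
                { isEquivalence = record { refl = ≈ᶜ-refl ; sym = ≈ᶜ-sym ; trans = ≈ᶜ-trans }
                ; ∙-cong = +ᶜ-cong }
              ; assoc = +ᶜ-assoc }
            ; identity = +ᶜ-identityˡ , +ᶜ-identityʳ }
          ; inverse = -ᶜ-inverseˡ , -ᶜ-inverseʳ
          ; ⁻¹-cong = -ᶜ-cong }
        ; comm = +ᶜ-comm }
      ; *-cong = *ᶜ-cong
      ; *-assoc = *ᶜ-assoc
      ; *-identity = *ᶜ-identityˡ , *ᶜ-identityʳ
      ; distrib = distribˡᶜ , distribʳᶜ }
    ; *-comm = *ᶜ-comm } }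

------------------------------------------------------------------------
-- Graded algebras and their isomorphisms.  As in the library's morphism
-- structures, only the operations enter into the notion of morphism.

record RawGradedAlgebra : Set₁ where
  field
    rawRing : RawRing 0ℓ 0ℓ
  open RawRing rawRing public using (Carrier)
  field
    _*ₗ_   : ℂ → Carrier → Carrier
    Degree : ℕ → Pred Carrier 0ℓ

record IsGradedAlgebraIsomorphism
  (A B : RawGradedAlgebra)
  (Φ : RawGradedAlgebra.Carrier A → RawGradedAlgebra.Carrier B) : Set where
  private
    module A = RawGradedAlgebra A
    module B = RawGradedAlgebra B
    open RawRing B.rawRing using () renaming (_≈_ to _≈ᴮ_)
  field
    isRingIsomorphism : RingMorphisms.IsRingIsomorphism A.rawRing B.rawRing Φ
    *ₗ-homo           : ∀ c f → Φ (c A.*ₗ f) ≈ᴮ c B.*ₗ Φ f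
    Degree-preserving : ∀ k f → A.Degree k f ⇔ B.Degree k (Φ f)

------------------------------------------------------------------------
-- The algebra ⊕_{m ∈ M} ℂ t^m of a commutative monoid M, with
-- t^m · t^m′ = t^(m ∙ m′), graded by a degree relation on M.

module MonoidAlgebra (M : CommutativeMonoid 0ℓ 0ℓ) where
  private
    module K = CommutativeRing ℂ-commutativeRing
    module M = CommutativeMonoid M

  -- (c₁ , m₁) ∷ … ∷ (cᵣ , mᵣ) ∷ [] stands for c₁ t^m₁ + … + cᵣ t^mᵣ.
  FormalSum : Set
  FormalSum = List (ℂ × M.Carrier)

  infix 4 _≋_

  -- Equality in the free ℂ-module on the setoid M.  It is generated
  -- inductively, since M need not have decidable equality and so the
  -- coefficient of a formal sum at m need not be computable.
  data _≋_ : FormalSum → FormalSum → Set where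
    ≋-refl  : ∀ {f} → f ≋ f
    ≋-sym   : ∀ {f g} → f ≋ g → g ≋ f
    ≋-trans : ∀ {f g h} → f ≋ g → g ≋ h → f ≋ h
    ≋-cons  : ∀ {c d m m′ f g} → c K.≈ d → m M.≈ m′ → f ≋ g →
              (c , m) ∷ f ≋ (d , m′) ∷ g
    ≋-swap  : ∀ {s t f} → s ∷ t ∷ f ≋ t ∷ s ∷ f
    ≋-merge : ∀ {c d m f} → (c , m) ∷ (d , m) ∷ f ≋ (c K.+ d , m) ∷ f
    ≋-zero  : ∀ {m f} → (K.0# , m) ∷ f ≋ f

  rawRing : RawRing 0ℓ 0ℓ
  rawRing = record
    { Carrier = FormalSum
    ; _≈_ = _≋_
    ; _+_ = _++_
    ; _*_ = cartesianProductWith λ (c , m) (d , m′) → (c K.* d , m M.∙ m′)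
    ; -_  = List.map (map₁ λ c → K.- c)
    ; 0#  = []
    ; 1#  = [ (K.1# , M.ε) ]
    }

  -- The degree-k component is the span of the t^m with m of degree k.
  rawGradedAlgebra : (HasDegree : M.Carrier → ℕ → Set) → RawGradedAlgebra
  rawGradedAlgebra HasDegree = record
    { rawRing = rawRing
    ; _*ₗ_    = λ c → List.map (map₁ (c K.*_))
    ; Degree  = λ k f → ∃[ g ] f ≋ g × All (λ (_ , m) → HasDegree m k) g
    }

-- The ℂ-linear extension of t^x ↦ t^(h x).
linearExtension : ∀ {X Y : Set} → (X → Y) → List (ℂ × X) → List (ℂ × Y)
linearExtension h = List.map (map₂ h)

------------------------------------------------------------------------
-- L-S paths

basis : ∀ {m} → Fin m → Vector ℝ m
basis i j = if does (i Fin.≟ j) then 1ℝ else 0ℝ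

module LSPaths {n : ℕ} (b : Vector ℕ n) (b≢0 : ∀ j → NonZero (b j)) where

  private instance
    b-nonZero : ∀ {j} → NonZero (b j)
    b-nonZero {j} = b≢0 j

  -- Counting from 1, as in v₁, …, vₙ₊₁: the basis vector at inject₁ j
  -- with j : Fin n is e_j, the one at suc j is e_{j+1}.
  generator : Fin (suc n) → Vector ℝ (suc n)
  generator i l with view i
  ... | ‵fromℕ     = basis (fromℕ n) l
  ... | ‵inject₁ j = (basis (inject₁ j) l - basis (suc j) l) / b j

  InLattice : Vector ℝ (suc n) → Set
  InLattice a = Σ[ c ∈ Vector ℤ (suc n) ] ∀ l → a l ≈ sum λ i → fromℤ (c i) * generator i l

  record LSPath : Set where
    no-eta-equality
    field
      coord     : Vector ℝ (suc n)
      inLattice : InLattice coord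
      coord≥0   : ∀ l → 0ℝ ≤ coord l

  open LSPath public

  deg : LSPath → ℝ
  deg π = sum (coord π)

  -- As l runs over Fin′ (suc i), inject l runs over the positions up to i.
  φ : Vector ℝ (suc n) → Vector ℝ n
  φ a i = fromℤ (+ b i) * sum λ (l : Fin′ (suc i)) → a (inject l)

  private
    lattice-0 : InLattice λ _ → 0ℝ
    lattice-0 = (λ _ → + 0) , λ l → Real.sym (Real.trans
      (Sum.sum-cong-≋ {suc n} λ i → Real.zeroˡ (generator i l)) (Sum.sum-replicate-zero (suc n)))

    lattice-+ : ∀ {a a′} → InLattice a → InLattice a′ → InLattice λ l → a l + a′ l
    lattice-+ (c , a≈) (c′ , a′≈) = (λ i → c i ℤ.+ c′ i) , λ l → Real.trans
      (+-cong (a≈ l) (a′≈ l))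
      (Real.sym (Real.trans
        (Sum.sum-cong-≋ λ i → Real.trans
          (*-cong (fromℤ-+ (c i) (c′ i)) Real.refl)
          (Real.distribʳ (generator i l) (fromℤ (c i)) (fromℤ (c′ i))))
        (Sum.∑-distrib-+ (λ i → fromℤ (c i) * generator i l) (λ i → fromℤ (c′ i) * generator i l))))

  LSPath-monoid : CommutativeMonoid 0ℓ 0ℓ
  LSPath-monoid = record
    { Carrier = LSPath
    ; _≈_ = λ π η → ∀ l → coord π l ≈ coord η l
    ; _∙_ = λ π η → record
        { coord     = λ l → coord π l + coord η l
        ; inLattice = lattice-+ (inLattice π) (inLattice η)
        ; coord≥0   = λ l → ≤-trans (≈⇒≤ (Real.sym (Real.+-identityˡ 0ℝ)))
                              (+-mono-≤ (coord≥0 π l) (coord≥0 η l)) }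
    ; ε = record
        { coord     = λ _ → 0ℝ
        ; inLattice = lattice-0
        ; coord≥0   = λ _ → ≈⇒≤ Real.refl }
    ; isCommutativeMonoid = record
      { isMonoid = record
        { isSemigroup = record
          { isMagma = record
            { isEquivalence = record
              { refl  = λ _ → Real.refl
              ; sym   = λ p l → Real.sym (p l)
              ; trans = λ p q l → Real.trans (p l) (q l) }
            ; ∙-cong = λ p q l → +-cong (p l) (q l) }
          ; assoc = λ π η θ l → Real.+-assoc (coord π l) (coord η l) (coord θ l) }
        ; identity = (λ π l → Real.+-identityˡ (coord π l))
                   , (λ π l → Real.+-identityʳ (coord π l)) }
      ; comm = λ π η l → Real.+-comm (coord π l) (coord η l) } }

  semigroupAlgebra : RawGradedAlgebra
  semigroupAlgebra = MonoidAlgebra.rawGradedAlgebra LSPath-monoid λ π k → deg π ≈ fromℤ (+ k)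

  ----------------------------------------------------------------------
  -- The lecture hall polytope and its Ehrhart ring

  InPolytope : Vector ℝ n → Set
  InPolytope x = Linked _≤_ (0ℝ ∷ tabulate (λ i → x i / b i) ∷ʳ 1ℝ)

  InDilate : ℕ → Vector ℝ n → Set
  InDilate k y = Σ[ x ∈ Vector ℝ n ] InPolytope x × (∀ i → y i ≈ fromℤ (+ k) * x i)

  record EhrhartPoint : Set where
    no-eta-equality
    field
      point    : Vector ℤ n
      level    : ℕ
      inDilate : InDilate level (fromℤ ∘ point)

  open EhrhartPoint public

  private
    polytope-0 : InPolytope λ _ → 0ℝ
    polytope-0 = chain (λ i → 0ℝ / b i) Real.refl λ i → Real.zeroʳ (fromℚ (+ 1 ℚ./ b i))
      where
      chain : ∀ {m u} (f : Vector ℝ m) → u ≈ 0ℝ → (∀ i → f i ≈ 0ℝ) → Linked _≤_ (u ∷ tabulate f ∷ʳ 1ℝ)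
      chain {zero}  f u≈0 f≈0 =
        ≤-trans (≈⇒≤ u≈0) (fromℚ-mono (ℚ.<⇒≤ (ℚ.positive⁻¹ 1ℚ))) ∷ [-]
      chain {suc m} f u≈0 f≈0 =
        ≈⇒≤ (Real.trans u≈0 (Real.sym (f≈0 zero))) ∷ chain (f ∘ suc) (f≈0 zero) (f≈0 ∘ suc)

    polytope-convex : ∀ {α β x y} → 0ℚ ℚ.≤ α → 0ℚ ℚ.≤ β → α ℚ.+ β ≡ 1ℚ →
      InPolytope x → InPolytope y → InPolytope λ i → fromℚ α * x i + fromℚ β * y i
    polytope-convex {α} {β} {x} {y} α≥0 β≥0 α+β≡1 = chain
      (λ i → x i / b i) (λ i → y i / b i) (λ i → (fromℚ α * x i + fromℚ β * y i) / b i)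
      (pointwise λ _ → combine-0 α β)
      (λ i → pointwise λ n → combine-/ α β (seq (x i) n) (seq (y i) n) (+ 1 ℚ./ b i))
      (Real.sym (Real.trans (+-cong (Real.*-identityʳ (fromℚ α)) (Real.*-identityʳ (fromℚ β)))
        (pointwise λ _ → α+β≡1)))
      where
      Combination : ℝ → ℝ → ℝ → Set
      Combination u v w = w ≈ fromℚ α * u + fromℚ β * v

      combine-0 : ∀ a c → 0ℚ ≡ a ℚ.* 0ℚ ℚ.+ c ℚ.* 0ℚ
      combine-0 = solve-∀ ℚ-ring

      combine-/ : ∀ a c u v d →
        d ℚ.* (a ℚ.* u ℚ.+ c ℚ.* v) ≡ a ℚ.* (d ℚ.* u) ℚ.+ c ℚ.* (d ℚ.* v)
      combine-/ = solve-∀ ℚ-ring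

      step : ∀ {u v w u′ v′ w′} → Combination u v w → Combination u′ v′ w′ → u ≤ u′ → v ≤ v′ → w ≤ w′
      step p q u≤ v≤ = ≤-trans (≈⇒≤ p) (≤-trans
        (+-mono-≤ (*-mono-≤ α α≥0 u≤) (*-mono-≤ β β≥0 v≤)) (≈⇒≤ (Real.sym q)))

      chain : ∀ {m u v w u′ v′ w′} (f g h : Vector ℝ m) →
        Combination u v w → (∀ i → Combination (f i) (g i) (h i)) → Combination u′ v′ w′ →
        Linked _≤_ (u ∷ tabulate f ∷ʳ u′) → Linked _≤_ (v ∷ tabulate g ∷ʳ v′) →
        Linked _≤_ (w ∷ tabulate h ∷ʳ w′)
      chain {zero}  f g h p q r (u≤ ∷ _)  (v≤ ∷ _)  = step p r u≤ v≤ ∷ [-]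
      chain {suc m} f g h p q r (u≤ ∷ us) (v≤ ∷ vs) =
        step p (q zero) u≤ v≤ ∷ chain (f ∘ suc) (g ∘ suc) (h ∘ suc) (q zero) (q ∘ suc) r us vs

    dilate-+ : ∀ k h {x y} → InDilate k x → InDilate h y → InDilate (k ℕ.+ h) λ i → x i + y i
    dilate-+ zero h (x′ , _ , x≈) (y′ , y′∈P , y≈) = y′ , y′∈P , λ i →
      Real.trans (+-cong (x≈ i) (y≈ i))
        (Real.trans (+-cong (Real.zeroˡ (x′ i)) ≈-refl) (+-identityˡ (fromℤ (+ h) * y′ i)))
    dilate-+ (suc k) h (x′ , x′∈P , x≈) (y′ , y′∈P , y≈) =
      (λ i → fromℚ α * x′ i + fromℚ β * y′ i) ,
      polytope-convex α≥0 β≥0 α+β≡1 x′∈P y′∈P ,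
      λ i → Real.trans
              (+-cong (Real.trans (x≈ i) (*-cong K≈ Real.refl)) (Real.trans (y≈ i) (*-cong H≈ Real.refl)))
              (pointwise λ n → lemma S α β (seq (x′ i) n) (seq (y′ i) n))
      where
      K = + suc k ℚ./ 1
      H = + h ℚ./ 1
      S = + (suc k ℕ.+ h) ℚ./ 1
      instance
        S-positive : ℚ.Positive S
        S-positive = ℚ.normalize-pos (suc k ℕ.+ h) 1
        S-nonZero : ℚ.NonZero S
        S-nonZero = ℚ.pos⇒nonZero S
        1/S-positive : ℚ.Positive (ℚ.1/ S)
        1/S-positive = ℚ.1/pos⇒pos S
        1/S-nonNegative : ℚ.NonNegative (ℚ.1/ S)
        1/S-nonNegative = ℚ.pos⇒nonNeg (ℚ.1/ S)
      α = ℚ.1/ S ℚ.* K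
      β = ℚ.1/ S ℚ.* H
      α≥0 : 0ℚ ℚ.≤ α
      α≥0 = ℚ.nonNegative⁻¹ α {{ℚ.nonNeg*nonNeg⇒nonNeg (ℚ.1/ S) K {{ℚ.normalize-nonNeg (suc k) 1}}}}
      β≥0 : 0ℚ ℚ.≤ β
      β≥0 = ℚ.nonNegative⁻¹ β {{ℚ.nonNeg*nonNeg⇒nonNeg (ℚ.1/ S) H {{ℚ.normalize-nonNeg h 1}}}}
      α+β≡1 : α ℚ.+ β ≡ 1ℚ
      α+β≡1 = ≡.trans (≡.sym (ℚ.*-distribˡ-+ (ℚ.1/ S) K H))
        (≡.trans (≡.cong (ℚ.1/ S ℚ.*_) (≡.sym (/1-homo-+ (+ suc k) (+ h)))) (ℚ.*-inverseˡ S))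
      S*1/S* : ∀ q → S ℚ.* (ℚ.1/ S ℚ.* q) ≡ q
      S*1/S* q = ≡.trans (≡.sym (ℚ.*-assoc S (ℚ.1/ S) q))
        (≡.trans (≡.cong (ℚ._* q) (ℚ.*-inverseʳ S)) (ℚ.*-identityˡ q))
      K≈ : fromℚ K ≈ fromℚ S * fromℚ α
      K≈ = pointwise λ _ → ≡.sym (S*1/S* K)
      H≈ : fromℚ H ≈ fromℚ S * fromℚ β
      H≈ = pointwise λ _ → ≡.sym (S*1/S* H)
      lemma : ∀ s a c u v →
        (s ℚ.* a) ℚ.* u ℚ.+ (s ℚ.* c) ℚ.* v ≡ s ℚ.* (a ℚ.* u ℚ.+ c ℚ.* v)
      lemma = solve-∀ ℚ-ring

  EhrhartPoint-monoid : CommutativeMonoid 0ℓ 0ℓ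
  EhrhartPoint-monoid = record
    { Carrier = EhrhartPoint
    ; _≈_ = λ P Q → (∀ i → point P i ≡ point Q i) × level P ≡ level Q
    ; _∙_ = λ P Q → record
        { point    = λ i → point P i ℤ.+ point Q i
        ; level    = level P ℕ.+ level Q
        ; inDilate = map₂ (map₂ λ eq i → Real.trans (fromℤ-+ (point P i) (point Q i)) (eq i))
                       (dilate-+ (level P) (level Q) (inDilate P) (inDilate Q)) }
    ; ε = record
        { point    = λ _ → + 0
        ; level    = 0
        ; inDilate = (λ _ → 0ℝ) , polytope-0 , λ _ → Real.sym (Real.zeroʳ 0ℝ) }
    ; isCommutativeMonoid = record
      { isMonoid = record
        { isSemigroup = record
          { isMagma = record
            { isEquivalence = record
              { refl  = (λ _ → ≡.refl) , ≡.refl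
              ; sym   = λ (p , k) → (λ i → ≡.sym (p i)) , ≡.sym k
              ; trans = λ (p , k) (q , h) → (λ i → ≡.trans (p i) (q i)) , ≡.trans k h }
            ; ∙-cong = λ (p , k) (q , h) → (λ i → ≡.cong₂ ℤ._+_ (p i) (q i)) , ≡.cong₂ ℕ._+_ k h }
          ; assoc = λ P Q T → (λ i → ℤ.+-assoc (point P i) (point Q i) (point T i))
                            , ℕ.+-assoc (level P) (level Q) (level T) }
        ; identity = (λ P → (λ i → ℤ.+-identityˡ (point P i)) , ≡.refl)
                   , (λ P → (λ i → ℤ.+-identityʳ (point P i)) , ℕ.+-identityʳ (level P)) }
      ; comm = λ P Q → (λ i → ℤ.+-comm (point P i) (point Q i)) , ℕ.+-comm (level P) (level Q) } }

  ehrhartRing : RawGradedAlgebra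
  ehrhartRing = MonoidAlgebra.rawGradedAlgebra EhrhartPoint-monoid λ P k → level P ≡ k

{-# OPTIONS --safe #-}

-- For a = ∑ cᵢ vᵢ the sum of the first i coordinates telescopes to cᵢ / bᵢ,
-- with bₙ₊₁ = 1.  Hence the coefficients of an L-S path are φ(a) followed by
-- the degree, and the coordinates of a are the consecutive differences of
-- 0, c₁/b₁, …, cₙ/bₙ, cₙ₊₁; they are non-negative exactly when (c₁, …, cₙ)
-- lies in the cₙ₊₁-th dilate of the polytope.  So a ↦ c is an isomorphism of
-- graded monoids, which extends linearly to their algebras.

module Submission where

open import Defs
open import Algebra.Bundles using (CommutativeMonoid; CommutativeRing)
open import Algebra.Morphism.Structures using (module MonoidMorphisms)
import Algebra.Properties.CommutativeSemigroup as CommutativeSemigroupProperties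
import Algebra.Properties.Semiring.Sum as SemiringSum
open import Data.Fin.Base using (Fin; zero; suc; fromℕ; inject; inject₁; Fin′)
open import Data.Fin.Relation.Unary.Top using (view-fromℕ; view-inject₁)
open import Data.Integer.Base as ℤ using (ℤ; +_)
import Data.Integer.Properties as ℤ
open import Data.List.Base as List using ([]; _∷_; _++_; _∷ʳ_; tabulate; cartesianProductWith)
import Data.List.Properties as List
open import Data.List.Relation.Unary.All as All using (All)
import Data.List.Relation.Unary.All.Properties as All
open import Data.List.Relation.Unary.Linked using (Linked; [-]; _∷_)
open import Data.Nat.Base as ℕ using (ℕ; zero; suc; NonZero)
import Data.Nat.Properties as ℕ
open import Data.Product.Base using (Σ-syntax; _×_; _,_; map₁; proj₁; proj₂)
open import Data.Rational.Base as ℚ using (ℚ; 0ℚ; 1ℚ)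
import Data.Rational.Properties as ℚ
import Data.Rational.Unnormalised.Base as ℚᵘ
import Data.Rational.Unnormalised.Properties as ℚᵘ
open import Data.Vec.Functional using (Vector; insertAt)
open import Function.Base using (_∘_)
open import Function.Bundles using (_⇔_; mk⇔; Equivalence)
open import Function.Definitions using (Congruent)
open import Level using (0ℓ)
open import Relation.Binary.Definitions using (_Respectsˡ_)
open import Relation.Binary.PropositionalEquality.Core as ≡ using (_≡_)
import Relation.Binary.Reasoning.Setoid as SetoidReasoning
open import Relation.Nullary.Decidable.Core using (dec⇒maybe)
open import Tactic.RingSolver using (solve-∀)
open import Tactic.RingSolver.Core.AlmostCommutativeRing
  using (AlmostCommutativeRing; fromCommutativeRing)

private
  module K = CommutativeRing ℂ-commutativeRing
  module Real = CommutativeRing ℝ-commutativeRing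
  module Sum = SemiringSum Real.semiring

  open CommutativeSemigroupProperties Real.*-commutativeSemigroup using (x∙yz≈y∙xz)

  ℚ-ring : AlmostCommutativeRing 0ℓ 0ℓ
  ℚ-ring = fromCommutativeRing ℚ.+-*-commutativeRing λ q → dec⇒maybe (0ℚ ℚ.≟ q)

-- Isomorphic graded monoids have isomorphic graded algebras

module _ (M N : CommutativeMonoid 0ℓ 0ℓ) where
  private
    module M = CommutativeMonoid M
    module N = CommutativeMonoid N
    module ℂM = MonoidAlgebra M
    module ℂN = MonoidAlgebra N

  -- Each rule generating `≋` is carried to the same rule; only `≋-cons` compares exponents and so
  -- needs that `h` respects equality.
  linearExtension-cong : ∀ {h : M.Carrier → N.Carrier} → Congruent M._≈_ N._≈_ h →
    Congruent ℂM._≋_ ℂN._≋_ (linearExtension h)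
  linearExtension-cong {h} h-cong = cong
    where
    cong : Congruent ℂM._≋_ ℂN._≋_ (linearExtension h)
    cong ℂM.≋-refl           = ℂN.≋-refl
    cong (ℂM.≋-sym p)        = ℂN.≋-sym (cong p)
    cong (ℂM.≋-trans p q)    = ℂN.≋-trans (cong p) (cong q)
    cong (ℂM.≋-cons c≈ m≈ p) = ℂN.≋-cons c≈ (h-cong m≈) (cong p)
    cong ℂM.≋-swap           = ℂN.≋-swap
    cong ℂM.≋-merge          = ℂN.≋-merge
    cong ℂM.≋-zero           = ℂN.≋-zero

  linearExtension-inverse : ∀ {h : M.Carrier → N.Carrier} {g} → (∀ m → g (h m) M.≈ m) →
    ∀ f → linearExtension g (linearExtension h f) ℂM.≋ f
  linearExtension-inverse inv []            = ℂM.≋-refl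
  linearExtension-inverse inv ((c , m) ∷ f) =
    ℂM.≋-cons K.refl (inv m) (linearExtension-inverse inv f)

module _ (M N : CommutativeMonoid 0ℓ 0ℓ) where
  private
    module M = CommutativeMonoid M
    module N = CommutativeMonoid N
    module ℂM = MonoidAlgebra M
    module ℂN = MonoidAlgebra N
    open MonoidMorphisms M.rawMonoid N.rawMonoid

  module _ {h : M.Carrier → N.Carrier}
    (h-homo : ∀ m m′ → h (m M.∙ m′) N.≈ h m N.∙ h m′) where

    -- Both products list the pairwise terms in the same order, so they match term by term, with
    -- `h-homo` applied to the exponents.
    linearExtension-*-homo : ∀ f f′ →
      linearExtension h (cartesianProductWith (λ (c , m) (d , m′) → (c K.* d , m M.∙ m′)) f f′) ℂN.≋
      cartesianProductWith (λ (c , m) (d , m′) → (c K.* d , m N.∙ m′))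
        (linearExtension h f) (linearExtension h f′)
    linearExtension-*-homo []            f′ = ℂN.≋-refl
    linearExtension-*-homo ((c , m) ∷ f) f′ = term-* f′ (linearExtension-*-homo f f′)
      where
      -- Handles the products of one term with all of `f′`; `r` and `r′` stand for the products of
      -- the remaining terms.
      term-* : ∀ f′ {r r′} → linearExtension h r ℂN.≋ r′ →
        linearExtension h (List.map (λ (d , m′) → (c K.* d , m M.∙ m′)) f′ ++ r) ℂN.≋
        List.map (λ (d , m′) → (c K.* d , h m N.∙ m′)) (linearExtension h f′) ++ r′
      term-* []             r≋ = r≋
      term-* ((d , m′) ∷ f′) r≋ = ℂN.≋-cons K.refl (h-homo m m′) (term-* f′ r≋)

  -- Surjectivity of `h` gives a section `g`; injectivity makes `g` a two-sided inverse that
  -- respects equality. The linear extension of `g` then inverts that of `h`.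
  linearExtension-isGradedAlgebraIsomorphism :
    ∀ {h} {D : M.Carrier → ℕ → Set} {E : N.Carrier → ℕ → Set} →
    IsMonoidIsomorphism h → E Respectsˡ N._≈_ → (∀ m k → D m k ⇔ E (h m) k) →
    IsGradedAlgebraIsomorphism (ℂM.rawGradedAlgebra D) (ℂN.rawGradedAlgebra E) (linearExtension h)
  linearExtension-isGradedAlgebraIsomorphism {h} {D} {E} h-iso E-resp D⇔E = record
    { isRingIsomorphism = record
      { isRingMonomorphism = record
        { isRingHomomorphism = record
          { isSemiringHomomorphism = record
            { isNearSemiringHomomorphism = record
              { +-isMonoidHomomorphism = record
                { isMagmaHomomorphism = record
                  { isRelHomomorphism = record { cong = h*-cong }
                  ; homo = λ f f′ → ≋-reflexive (List.map-++ _ f f′) }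
                ; ε-homo = ℂN.≋-refl }
              ; *-homo = linearExtension-*-homo h.homo }
            ; 1#-homo = ℂN.≋-cons K.refl h.ε-homo ℂN.≋-refl }
          ; -‿homo = map₁-homo }
        ; injective = λ {f} {f′} p → ℂM.≋-trans (ℂM.≋-sym (g*∘h* f))
            (ℂM.≋-trans (g*-cong p) (g*∘h* f′)) }
      ; surjective = λ f → linearExtension g f , λ p → ℂN.≋-trans (h*-cong p) (h*∘g* f) }
    ; *ₗ-homo = λ _ → map₁-homo
    ; Degree-preserving = λ k f → mk⇔
        (λ (f′ , f≋f′ , degs) → linearExtension h f′ , h*-cong f≋f′ ,
          All.map⁺ (All.map (λ {(_ , m)} → Equivalence.to (D⇔E m k)) degs))
        -- A homogeneous element need only have some homogeneous representative, so the one given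
        -- for the image is pulled back along `g`.
        (λ (f′ , hf≋f′ , degs) → linearExtension g f′ ,
          ℂM.≋-trans (ℂM.≋-sym (g*∘h* f)) (g*-cong hf≋f′) ,
          All.map⁺ (All.map (λ {(_ , m)} →
            Equivalence.from (D⇔E (g m) k) ∘ E-resp (N.sym (h∘g m))) degs)) }
    where
    module h = IsMonoidIsomorphism h-iso

    g : N.Carrier → M.Carrier
    g y = proj₁ (h.surjective y)

    h∘g : ∀ y → h (g y) N.≈ y
    h∘g y = proj₂ (h.surjective y) M.refl

    g∘h : ∀ x → g (h x) M.≈ x
    g∘h x = h.injective (h∘g (h x))

    g-cong : Congruent N._≈_ M._≈_ g
    g-cong {x} {y} x≈y = h.injective (N.trans (h∘g x) (N.trans x≈y (N.sym (h∘g y))))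

    h*-cong : Congruent ℂM._≋_ ℂN._≋_ (linearExtension h)
    h*-cong = linearExtension-cong M N h.⟦⟧-cong

    g*-cong : Congruent ℂN._≋_ ℂM._≋_ (linearExtension g)
    g*-cong = linearExtension-cong N M g-cong

    h*∘g* : ∀ f → linearExtension h (linearExtension g f) ℂN.≋ f
    h*∘g* = linearExtension-inverse N M h∘g

    g*∘h* : ∀ f → linearExtension g (linearExtension h f) ℂM.≋ f
    g*∘h* = linearExtension-inverse M N g∘h

    ≋-reflexive : ∀ {f f′} → f ≡ f′ → f ℂN.≋ f′
    ≋-reflexive ≡.refl = ℂN.≋-refl

    -- Covers negation and scalar multiplication at once: `s` acts on coefficients and `h` on
    -- exponents, so both composites fuse to one map.
    map₁-homo : ∀ {s : ℂ → ℂ} f →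
      linearExtension h (List.map (map₁ s) f) ℂN.≋ List.map (map₁ s) (linearExtension h f)
    map₁-homo f = ≋-reflexive (≡.trans (≡.sym (List.map-∘ f)) (List.map-∘ f))

-- Real numbers

≤-resp-≈ : ∀ {x x′ y y′} → x ≈ x′ → y ≈ y′ → x ≤ y → x′ ≤ y′
≤-resp-≈ x≈x′ y≈y′ x≤y = ≤-trans (≈⇒≤ (Real.sym x≈x′)) (≤-trans x≤y (≈⇒≤ y≈y′))

x≤y⇒0≤y-x : ∀ {x y} → x ≤ y → 0ℝ ≤ y - x
x≤y⇒0≤y-x {x} x≤y = ≤-resp-≈ (Real.-‿inverseʳ x) Real.refl (+-mono-≤ x≤y (≈⇒≤ (Real.refl { - x})))

0≤y-x⇒x≤y : ∀ {x y} → 0ℝ ≤ y - x → x ≤ y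
0≤y-x⇒x≤y {x} {y} 0≤y-x = ≤-resp-≈ (Real.+-identityˡ x)
  (Real.trans (Real.+-assoc y (- x) x)
    (Real.trans (Real.+-congˡ (Real.-‿inverseˡ x)) (Real.+-identityʳ y)))
  (+-mono-≤ 0≤y-x (≈⇒≤ (Real.refl {x})))

sum≥0 : ∀ {n} {f : Vector ℝ n} → (∀ i → 0ℝ ≤ f i) → 0ℝ ≤ sum f
sum≥0 {zero}  f≥0 = ≈⇒≤ Real.refl
sum≥0 {suc n} f≥0 = ≤-resp-≈ (Real.+-identityˡ 0ℝ) Real.refl
  (+-mono-≤ (f≥0 zero) (sum≥0 (f≥0 ∘ suc)))

x-0≈x : ∀ x → x - 0ℝ ≈ x
x-0≈x x = pointwise λ m → ℚ.+-identityʳ (seq x m)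

-- If `q < p`, taking `p - q` itself as the tolerance yields `p - q < p - q`.
fromℚ-cancel-≤ : ∀ {p q} → fromℚ p ≤ fromℚ q → p ℚ.≤ q
fromℚ-cancel-≤ {p} {q} p≤q = ℚ.≮⇒≥ λ q<p →
  let N , p-q<p-q = below p≤q (p ℚ.- q)
        (≡.subst (ℚ._< p ℚ.- q) (ℚ.+-inverseʳ q) (ℚ.+-monoˡ-< (ℚ.- q) q<p))
  in ℚ.<-irrefl ≡.refl (p-q<p-q (ℕ.≤-refl {N}))

toℚᵘ-/1 : ∀ i → ℚ.toℚᵘ (i ℚ./ 1) ℚᵘ.≃ ℚᵘ.mkℚᵘ i 0
toℚᵘ-/1 i = ℚ.toℚᵘ-fromℚᵘ (ℚᵘ.mkℚᵘ i 0)

fromℤ-cancel-≤ : ∀ {i j} → fromℤ i ≤ fromℤ j → i ℤ.≤ j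
fromℤ-cancel-≤ {i} {j} i≤j = ≡.subst₂ ℤ._≤_ (ℤ.*-identityʳ i) (ℤ.*-identityʳ j)
  (ℚᵘ.drop-*≤* (ℚᵘ.≤-respˡ-≃ (toℚᵘ-/1 i) (ℚᵘ.≤-respʳ-≃ (toℚᵘ-/1 j)
    (ℚ.toℚᵘ-mono-≤ (fromℚ-cancel-≤ i≤j)))))

fromℤ-injective : ∀ {i j} → fromℤ i ≈ fromℤ j → i ≡ j
fromℤ-injective i≈j = ℤ.≤-antisym
  (fromℤ-cancel-≤ (≈⇒≤ i≈j)) (fromℤ-cancel-≤ (≈⇒≤ (Real.sym i≈j)))

1/d*d≡1 : ∀ d .{{_ : NonZero d}} → (+ 1 ℚ./ d) ℚ.* (+ d ℚ./ 1) ≡ 1ℚ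
1/d*d≡1 (suc d) = ℚ.toℚᵘ-injective (ℚᵘ.≃-trans
  (ℚ.toℚᵘ-homo-* (+ 1 ℚ./ suc d) (+ suc d ℚ./ 1))
  (ℚᵘ.≃-trans
    (ℚᵘ.*-cong (ℚ.toℚᵘ-fromℚᵘ (ℚᵘ.mkℚᵘ (+ 1) d)) (toℚᵘ-/1 (+ suc d)))
    (ℚᵘ.*≡* (≡.cong +_ (≡.trans (ℕ.*-identityʳ (suc d ℕ.+ 0))
      (≡.cong (ℕ._+ 0) (≡.sym (ℕ.*-identityʳ (suc d)))))))))

1/d≥0 : ∀ d .{{_ : NonZero d}} → 0ℚ ℚ.≤ + 1 ℚ./ d
1/d≥0 d = ℚ.nonNegative⁻¹ (+ 1 ℚ./ d) {{ℚ.normalize-nonNeg 1 d}}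

k/1≥0 : ∀ k → 0ℚ ℚ.≤ + k ℚ./ 1
k/1≥0 k = ℚ.nonNegative⁻¹ (+ k ℚ./ 1) {{ℚ.normalize-nonNeg k 1}}

d*[x/d]≈x : ∀ x d .{{_ : NonZero d}} → fromℤ (+ d) * (x / d) ≈ x
d*[x/d]≈x x d = pointwise λ n → ≡.trans (lemma (+ d ℚ./ 1) (+ 1 ℚ./ d) (seq x n))
  (≡.trans (≡.cong (ℚ._* seq x n) (1/d*d≡1 d)) (ℚ.*-identityˡ (seq x n)))
  where
  lemma : ∀ d e x → d ℚ.* (e ℚ.* x) ≡ (e ℚ.* d) ℚ.* x
  lemma = solve-∀ ℚ-ring

-- Consecutive differences

module _ {X : Set} where

  snoc : ∀ {n} → Vector X n → X → Vector X (suc n)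
  snoc {n} f w = insertAt f (fromℕ n) w

  snoc-inject₁ : ∀ {n} (f : Vector X n) w i → snoc f w (inject₁ i) ≡ f i
  snoc-inject₁ f w zero    = ≡.refl
  snoc-inject₁ f w (suc i) = snoc-inject₁ (f ∘ suc) w i

  snoc-fromℕ : ∀ {n} (f : Vector X n) w → snoc f w (fromℕ n) ≡ w
  snoc-fromℕ {zero}  f w = ≡.refl
  snoc-fromℕ {suc n} f w = snoc-fromℕ (f ∘ suc) w

snoc-cong : ∀ {n} {f f′ : Vector ℝ n} {w w′} → (∀ i → f i ≈ f′ i) → w ≈ w′ →
  ∀ i → snoc f w i ≈ snoc f′ w′ i
snoc-cong {zero}  f≈ w≈ zero    = w≈
snoc-cong {suc n} f≈ w≈ zero    = f≈ zero
snoc-cong {suc n} f≈ w≈ (suc i) = snoc-cong (f≈ ∘ suc) w≈ i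

-- `u` is the value preceding the first entry, so no entry is lost.
differences : ∀ {n} → ℝ → Vector ℝ n → Vector ℝ n
differences u f zero    = f zero - u
differences u f (suc i) = differences (f zero) (f ∘ suc) i


differences-cong : ∀ {n u u′} {f f′ : Vector ℝ n} → u ≈ u′ → (∀ i → f i ≈ f′ i) →
  ∀ i → differences u f i ≈ differences u′ f′ i
differences-cong u≈ f≈ zero    = Real.+-cong (f≈ zero) (Real.-‿cong u≈)
differences-cong u≈ f≈ (suc i) = differences-cong (f≈ zero) (f≈ ∘ suc) i

telescope : ∀ x y z → (y - x) + (z - y) ≈ z - x
telescope x y z = pointwise λ n → lemma (seq x n) (seq y n) (seq z n)
  where
  lemma : ∀ x y z → (y ℚ.- x) ℚ.+ (z ℚ.- y) ≡ z ℚ.- x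
  lemma = solve-∀ ℚ-ring

sum-differences : ∀ {n} u (f : Vector ℝ (suc n)) → sum (differences u f) ≈ f (fromℕ n) - u
sum-differences {zero}  u f = Real.+-identityʳ (f zero - u)
sum-differences {suc n} u f = Real.trans
  (Real.+-congˡ (sum-differences (f zero) (f ∘ suc)))
  (telescope u (f zero) (f (suc (fromℕ n))))

-- `Fin′ (suc i)` includes position `i` itself, so the telescoping sum ends at `f (inject₁ i)`.
partialSum-differences : ∀ {n} u (f : Vector ℝ (suc n)) (i : Fin n) →
  sum (λ (l : Fin′ (suc i)) → differences u f (inject l)) ≈ f (inject₁ i) - u
partialSum-differences u f zero    = Real.+-identityʳ (f zero - u)
partialSum-differences u f (suc i) = Real.trans
  (Real.+-congˡ (partialSum-differences (f zero) (f ∘ suc) i))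
  (telescope u (f zero) (f (suc (inject₁ i))))

-- Each link of the chain is the sign condition on one difference. With the converse below, this
-- matches the inequalities of the polytope with the non-negativity of a path.
linked⇒differences≥0 : ∀ {n u w} (f : Vector ℝ n) → Linked _≤_ (u ∷ tabulate f ∷ʳ w) →
  ∀ i → 0ℝ ≤ differences u (snoc f w) i
linked⇒differences≥0 {zero}  f (u≤w ∷ _)  zero    = x≤y⇒0≤y-x u≤w
linked⇒differences≥0 {suc n} f (u≤f₀ ∷ _) zero    = x≤y⇒0≤y-x u≤f₀
linked⇒differences≥0 {suc n} f (_ ∷ f↗)   (suc i) = linked⇒differences≥0 (f ∘ suc) f↗ i

differences≥0⇒linked : ∀ {n u w} (f : Vector ℝ n) → (∀ i → 0ℝ ≤ differences u (snoc f w) i) →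
  Linked _≤_ (u ∷ tabulate f ∷ʳ w)
differences≥0⇒linked {zero}  f Δ≥0 = 0≤y-x⇒x≤y (Δ≥0 zero) ∷ [-]
differences≥0⇒linked {suc n} f Δ≥0 =
  0≤y-x⇒x≤y (Δ≥0 zero) ∷ differences≥0⇒linked (f ∘ suc) (Δ≥0 ∘ suc)

linked⇒≤last : ∀ {n u w} (f : Vector ℝ n) → Linked _≤_ (u ∷ tabulate f ∷ʳ w) → u ≤ w
linked⇒≤last {zero}  f (u≤w ∷ _)   = u≤w
linked⇒≤last {suc n} f (u≤f₀ ∷ f↗) = ≤-trans u≤f₀ (linked⇒≤last (f ∘ suc) f↗)

-- Serves the zeroth dilate, where both ends are 0 and squeeze every entry.
linked⇒bounded : ∀ {n u w} (f : Vector ℝ n) → Linked _≤_ (u ∷ tabulate f ∷ʳ w) →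
  ∀ i → u ≤ f i × f i ≤ w
linked⇒bounded f (u≤f₀ ∷ f↗) zero    = u≤f₀ , linked⇒≤last (f ∘ suc) f↗
linked⇒bounded f (u≤f₀ ∷ f↗) (suc i) =
  let f₀≤ , ≤w = linked⇒bounded (f ∘ suc) f↗ i in ≤-trans u≤f₀ f₀≤ , ≤w

-- Used in both directions between the polytope and its dilates, with factor `k` or `1/k`. The
-- scaled chain is given up to `≈` so that the factors may be rearranged.
linked-scale : ∀ {n} q → 0ℚ ℚ.≤ q → ∀ {u u′ w w′} (f f′ : Vector ℝ n) →
  fromℚ q * u ≈ u′ → (∀ i → fromℚ q * f i ≈ f′ i) → fromℚ q * w ≈ w′ →
  Linked _≤_ (u ∷ tabulate f ∷ʳ w) → Linked _≤_ (u′ ∷ tabulate f′ ∷ʳ w′)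
linked-scale {zero}  q q≥0 f f′ u≈ f≈ w≈ (u≤w ∷ _)   =
  ≤-resp-≈ u≈ w≈ (*-mono-≤ q q≥0 u≤w) ∷ [-]
linked-scale {suc n} q q≥0 f f′ u≈ f≈ w≈ (u≤f₀ ∷ f↗) =
  ≤-resp-≈ u≈ (f≈ zero) (*-mono-≤ q q≥0 u≤f₀) ∷
  linked-scale q q≥0 (f ∘ suc) (f′ ∘ suc) (f≈ zero) (f≈ ∘ suc) w≈ f↗

-- Abel summation against the basis vectors.
∑-basis-differences : ∀ {n} u (f : Vector ℝ n) w l →
  - u * basis zero l +
    (sum (λ j → f j * (basis (inject₁ j) l - basis (suc j) l)) + w * basis (fromℕ n) l)
  ≈ differences u (snoc f w) l
∑-basis-differences {zero} u f w zero =
  pointwise λ n → lemma (seq u n) (seq w n)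
  where
  lemma : ∀ u w → (ℚ.- u) ℚ.* 1ℚ ℚ.+ (0ℚ ℚ.+ w ℚ.* 1ℚ) ≡ w ℚ.- u
  lemma = solve-∀ ℚ-ring
-- At coordinate zero only the `u` term and the first summand survive.
∑-basis-differences {suc n} u f w zero = Real.trans
  (Real.+-congˡ (Real.+-congʳ (Real.+-congˡ (Real.trans
    (Sum.sum-cong-≋ λ j → pointwise λ m → zero-term (seq (f (suc j)) m))
    (Sum.sum-replicate-zero n)))))
  (pointwise λ m → lemma (seq u m) (seq (f zero) m) (seq w m))
  where
  zero-term : ∀ x → x ℚ.* (0ℚ ℚ.- 0ℚ) ≡ 0ℚ
  zero-term = solve-∀ ℚ-ring
  lemma : ∀ u x w →
    (ℚ.- u) ℚ.* 1ℚ ℚ.+ ((x ℚ.* (1ℚ ℚ.- 0ℚ) ℚ.+ 0ℚ) ℚ.+ w ℚ.* 0ℚ) ≡ x ℚ.- u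
  lemma = solve-∀ ℚ-ring
-- The `u` term vanishes here, and the first summand leaves `- f zero * basis zero l`, the leading
-- term of the induction hypothesis with `f zero` in place of `u`.
∑-basis-differences {suc n} u f w (suc l) = Real.trans
  (pointwise λ m → lemma (seq u m) (seq (f zero) m) (seq (basis zero l) m) (seq S m) (seq W m))
  (∑-basis-differences (f zero) (f ∘ suc) w l)
  where
  S = sum λ j → f (suc j) * (basis (inject₁ j) l - basis (suc j) l)
  W = w * basis (fromℕ n) l
  lemma : ∀ u x e s w →
    (ℚ.- u) ℚ.* 0ℚ ℚ.+ ((x ℚ.* (0ℚ ℚ.- e) ℚ.+ s) ℚ.+ w) ≡ (ℚ.- x) ℚ.* e ℚ.+ (s ℚ.+ w)
  lemma = solve-∀ ℚ-ring

-- Lattice vectors in terms of their coefficients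

module _ {n : ℕ} (b : Vector ℕ n) (b≢0 : ∀ j → NonZero (b j)) where
  open LSPaths b b≢0
  private
    module A = CommutativeMonoid LSPath-monoid
    module E = CommutativeMonoid EhrhartPoint-monoid
    instance
      b-nonZero : ∀ {j} → NonZero (b j)
      b-nonZero {j} = b≢0 j

  -- `generator` is defined by cases on `view` and computes only once the view of the index is
  -- rewritten.
  generator-inject₁ : ∀ j l → generator (inject₁ j) l ≡ (basis (inject₁ j) l - basis (suc j) l) / b j
  generator-inject₁ j l rewrite view-inject₁ j = ≡.refl

  generator-fromℕ : ∀ l → generator (fromℕ n) l ≡ basis (fromℕ n) l
  generator-fromℕ l rewrite view-fromℕ n = ≡.refl

  ratios : Vector ℤ n → Vector ℝ n
  ratios p i = fromℤ (p i) / b i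

  -- The partial sums of the coordinates of ∑ cᵢ vᵢ.
  heights : Vector ℤ (suc n) → Vector ℝ (suc n)
  heights c = snoc (ratios (c ∘ inject₁)) (fromℤ (c (fromℕ n)))

  -- The factor `1 / b j` moves from the generator to its coefficient; Abel summation then applies
  -- with starting value 0.
  combination≈differences : ∀ c l →
    sum (λ i → fromℤ (c i) * generator i l) ≈ differences 0ℝ (heights c) l
  combination≈differences c l = begin
    sum (λ i → fromℤ (c i) * generator i l)
      ≈⟨ Sum.sum-init-last (λ i → fromℤ (c i) * generator i l) ⟩
    sum (λ j → fromℤ (c (inject₁ j)) * generator (inject₁ j) l) + C * generator (fromℕ n) l
      ≈⟨ Real.+-cong (Sum.sum-cong-≋ term) (Real.*-congˡ (Real.reflexive (generator-fromℕ l))) ⟩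
    S + C * basis (fromℕ n) l
      -- The vanishing term is inserted to reach the form of the Abel summation with `u = 0ℝ`.
      ≈⟨ pointwise (λ m → lemma (seq (basis {suc n} zero l) m) (seq (S + C * basis (fromℕ n) l) m)) ⟩
    - 0ℝ * basis zero l + (S + C * basis (fromℕ n) l)
      ≈⟨ ∑-basis-differences 0ℝ q C l ⟩
    differences 0ℝ (heights c) l ∎
    where
    open SetoidReasoning Real.setoid
    C = fromℤ (c (fromℕ n))
    q = ratios (c ∘ inject₁)
    S = sum λ j → q j * (basis (inject₁ j) l - basis (suc j) l)
    lemma : ∀ e s → s ≡ (ℚ.- 0ℚ) ℚ.* e ℚ.+ s
    lemma = solve-∀ ℚ-ring
    swap : ∀ c d e → c ℚ.* (d ℚ.* e) ≡ (d ℚ.* c) ℚ.* e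
    swap = solve-∀ ℚ-ring
    term : ∀ j → fromℤ (c (inject₁ j)) * generator (inject₁ j) l ≈
                 q j * (basis (inject₁ j) l - basis (suc j) l)
    term j = Real.trans (Real.*-congˡ (Real.reflexive (generator-inject₁ j l)))
      (pointwise λ m → swap (seq (fromℤ (c (inject₁ j))) m) (+ 1 ℚ./ b j)
        (seq (basis (inject₁ j) l - basis (suc j) l) m))

  -- Dilates of the polytope as chains of ratios

  Chain : ℕ → Vector ℤ n → Set
  Chain k p = Linked _≤_ (0ℝ ∷ tabulate (ratios p) ∷ʳ fromℤ (+ k))

  -- For positive `k` the chain is divided by `k`. For `k = 0` it runs from 0 to 0, which forces `p`
  -- to vanish.
  chain⇒inDilate : ∀ k p → Chain k p → InDilate k (fromℤ ∘ p)
  -- The witness is the origin; its membership in the polytope is read off from the neutral Ehrhart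
  -- point.
  chain⇒inDilate zero p p↗ = (λ _ → 0ℝ) , proj₁ (proj₂ (inDilate E.ε)) , λ i →
    Real.trans (Real.reflexive (≡.cong fromℤ (p≡0 i))) (Real.sym (Real.zeroʳ 0ℝ))
    where
    p≡0 : ∀ i → p i ≡ + 0
    p≡0 i =
      let 0≤q , q≤0 = linked⇒bounded (ratios p) p↗ i
          B   = + b i ℚ./ 1
          0≈  = Real.zeroʳ (fromℚ B)
          bq≈ = d*[x/d]≈x (fromℤ (p i)) (b i)
      in ℤ.≤-antisym
           (fromℤ-cancel-≤ (≤-resp-≈ bq≈ 0≈ (*-mono-≤ B (k/1≥0 (b i)) q≤0)))
           (fromℤ-cancel-≤ (≤-resp-≈ 0≈ bq≈ (*-mono-≤ B (k/1≥0 (b i)) 0≤q)))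
  chain⇒inDilate (suc k) p p↗ = x , linked-scale r (1/d≥0 (suc k)) _ _ (Real.zeroʳ (fromℚ r))
    (λ i → x∙yz≈y∙xz (fromℚ r) (fromℚ (+ 1 ℚ./ b i)) (fromℤ (p i)))
    (pointwise λ _ → 1/d*d≡1 (suc k)) p↗ ,
    λ i → Real.sym (d*[x/d]≈x (fromℤ (p i)) (suc k))
    where
    r = + 1 ℚ./ suc k
    x : Vector ℝ n
    x i = fromℤ (p i) / suc k

  -- Multiplying the polytope inequalities by `k` turns the upper end 1 into `k`, for `k = 0` as
  -- well.
  inDilate⇒chain : ∀ k p → InDilate k (fromℤ ∘ p) → Chain k p
  inDilate⇒chain k p (x , x∈P , p≈kx) = linked-scale K (k/1≥0 k) _ _ (Real.zeroʳ (fromℚ K))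
    (λ i → Real.trans (x∙yz≈y∙xz (fromℚ K) (fromℚ (+ 1 ℚ./ b i)) (x i))
      (Real.*-congˡ (Real.sym (p≈kx i))))
    (Real.*-identityʳ (fromℚ K)) x∈P
    where
    K = + k ℚ./ 1

  -- The isomorphism of graded monoids

  coefficients : LSPath → Vector ℤ (suc n)
  coefficients π = proj₁ (inLattice π)

  coord≈differences : ∀ π l → coord π l ≈ differences 0ℝ (heights (coefficients π)) l
  coord≈differences π l = Real.trans (proj₂ (inLattice π) l)
    (combination≈differences (coefficients π) l)

  -- The partial sum telescopes from 0 to the height `c_i / b_i`, and the factor `b_i` in `φ`
  -- cancels the denominator.
  φ≈coefficient : ∀ π i → φ (coord π) i ≈ fromℤ (coefficients π (inject₁ i))
  φ≈coefficient π i = begin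
    B * sum (λ (l : Fin′ (suc i)) → coord π (inject l))
      ≈⟨ Real.*-congˡ (Sum.sum-cong-≋ λ (l : Fin′ (suc i)) → coord≈differences π (inject l)) ⟩
    B * sum (λ (l : Fin′ (suc i)) → differences 0ℝ h (inject l))
      ≈⟨ Real.*-congˡ (partialSum-differences 0ℝ h i) ⟩
    B * (h (inject₁ i) - 0ℝ)
      ≈⟨ Real.*-congˡ (x-0≈x (h (inject₁ i))) ⟩
    B * h (inject₁ i)
      ≡⟨ ≡.cong (B *_) (snoc-inject₁ (ratios (coefficients π ∘ inject₁)) _ i) ⟩
    B * (fromℤ (coefficients π (inject₁ i)) / b i)
      ≈⟨ d*[x/d]≈x _ (b i) ⟩
    fromℤ (coefficients π (inject₁ i)) ∎
    where
    open SetoidReasoning Real.setoid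
    B = fromℤ (+ b i)
    h = heights (coefficients π)

  deg≈coefficient : ∀ π → deg π ≈ fromℤ (coefficients π (fromℕ n))
  deg≈coefficient π = begin
    sum (coord π)                ≈⟨ Sum.sum-cong-≋ (coord≈differences π) ⟩
    sum (differences 0ℝ h)       ≈⟨ sum-differences 0ℝ h ⟩
    h (fromℕ n) - 0ℝ             ≈⟨ x-0≈x (h (fromℕ n)) ⟩
    h (fromℕ n)                  ≡⟨ snoc-fromℕ (ratios (coefficients π ∘ inject₁)) _ ⟩
    fromℤ (coefficients π (fromℕ n)) ∎
    where
    open SetoidReasoning Real.setoid
    h = heights (coefficients π)

  -- This coefficient is the degree, a sum of non-negative coordinates; hence the absolute value in
  -- `degree` changes nothing.
  lastCoefficient≥0 : ∀ π → + 0 ℤ.≤ coefficients π (fromℕ n)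
  lastCoefficient≥0 π = fromℤ-cancel-≤
    (≤-resp-≈ Real.refl (deg≈coefficient π) (sum≥0 (coord≥0 π)))

  degree : LSPath → ℕ
  degree π = ℤ.∣ coefficients π (fromℕ n) ∣

  +degree : ∀ π → + degree π ≡ coefficients π (fromℕ n)
  +degree π = ℤ.0≤i⇒+∣i∣≡i (lastCoefficient≥0 π)

  toEhrhart : LSPath → EhrhartPoint
  toEhrhart π = record
    { point    = coefficients π ∘ inject₁
    ; level    = degree π
    ; inDilate = chain⇒inDilate (degree π) (coefficients π ∘ inject₁)
        -- The differences give a chain ending at the last coefficient, an integer, which is
        -- rewritten as the natural number `degree π`.
        (≡.subst (λ w → Linked _≤_ (0ℝ ∷ tabulate (ratios (coefficients π ∘ inject₁)) ∷ʳ fromℤ w))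
          (≡.sym (+degree π))
          (differences≥0⇒linked _ λ l → ≤-resp-≈ Real.refl (coord≈differences π l) (coord≥0 π l)))
    }

  toEhrhart-φ : ∀ π i → fromℤ (point (toEhrhart π) i) ≈ φ (coord π) i
  toEhrhart-φ π i = Real.sym (φ≈coefficient π i)

  toEhrhart-deg : ∀ π → fromℤ (+ level (toEhrhart π)) ≈ deg π
  toEhrhart-deg π = Real.trans (Real.reflexive (≡.cong fromℤ (+degree π)))
    (Real.sym (deg≈coefficient π))

  -- Equal paths may carry separately chosen coefficient vectors. These agree because `φ` and `deg`
  -- depend on the coordinates alone and `fromℤ` is injective.
  toEhrhart-cong : Congruent A._≈_ E._≈_ toEhrhart
  toEhrhart-cong {π} {η} π≈η =
    (λ i → fromℤ-injective (Real.trans (toEhrhart-φ π i)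
      (Real.trans (Real.*-congˡ (Sum.sum-cong-≋ λ (l : Fin′ (suc i)) → π≈η (inject l)))
        (Real.sym (toEhrhart-φ η i))))) ,
    ℤ.+-injective (fromℤ-injective (Real.trans (toEhrhart-deg π)
      (Real.trans (Sum.sum-cong-≋ π≈η) (Real.sym (toEhrhart-deg η)))))

  -- The sum of two paths stores the sum of their coefficients, so the points agree by computation.
  -- The levels are compared in ℤ, where `+degree` removes the absolute values.
  toEhrhart-homo : ∀ π η → toEhrhart (π A.∙ η) E.≈ toEhrhart π E.∙ toEhrhart η
  toEhrhart-homo π η = (λ _ → ≡.refl) , ℤ.+-injective
    (≡.trans (+degree (π A.∙ η)) (≡.cong₂ ℤ._+_ (≡.sym (+degree π)) (≡.sym (+degree η))))

  -- Point and level are all the coefficients, and these determine the heights and so the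
  -- coordinates.
  toEhrhart-injective : ∀ {π η} → toEhrhart π E.≈ toEhrhart η → π A.≈ η
  toEhrhart-injective {π} {η} (p≡ , k≡) l = Real.trans (coord≈differences π l)
    (Real.trans (differences-cong Real.refl (snoc-cong
        (λ i → Real.*-congˡ (Real.reflexive (≡.cong fromℤ (p≡ i))))
        (Real.reflexive (≡.cong fromℤ
          (≡.trans (≡.sym (+degree π)) (≡.trans (≡.cong +_ k≡) (+degree η)))))) l)
      (Real.sym (coord≈differences η l)))

  fromEhrhart : EhrhartPoint → LSPath
  fromEhrhart P = record
    { coord     = λ l → sum λ i → fromℤ (c i) * generator i l
    ; inLattice = c , λ _ → Real.refl
    ; coord≥0   = λ l → ≤-resp-≈ Real.refl
        (Real.trans
          (differences-cong Real.refl (snoc-cong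
            (λ i → Real.*-congˡ (Real.reflexive (≡.cong fromℤ (≡.sym (snoc-inject₁ (point P) (+ level P) i)))))
            (Real.reflexive (≡.cong fromℤ (≡.sym (snoc-fromℕ (point P) (+ level P)))))) l)
          (Real.sym (combination≈differences c l)))
        -- The coordinates are the gaps in the chain given by membership in the dilate.
        (linked⇒differences≥0 _ (inDilate⇒chain (level P) (point P) (inDilate P)) l)
    }
    where
    c : Vector ℤ (suc n)
    c = snoc (point P) (+ level P)

  -- `fromEhrhart` stores its own coefficient vector, so it suffices to read off the entries of
  -- `snoc`.
  toEhrhart-fromEhrhart : ∀ P → toEhrhart (fromEhrhart P) E.≈ P
  toEhrhart-fromEhrhart P = snoc-inject₁ (point P) (+ level P) ,
    ≡.cong ℤ.∣_∣ (snoc-fromℕ (point P) (+ level P))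

  toEhrhart-isMonoidIsomorphism :
    MonoidMorphisms.IsMonoidIsomorphism A.rawMonoid E.rawMonoid toEhrhart
  toEhrhart-isMonoidIsomorphism = record
    { isMonoidMonomorphism = record
      { isMonoidHomomorphism = record
        { isMagmaHomomorphism = record
          { isRelHomomorphism = record { cong = λ {π} {η} → toEhrhart-cong {π} {η} }
          ; homo = toEhrhart-homo }
        ; ε-homo = (λ _ → ≡.refl) , ≡.refl }
      ; injective = λ {π} {η} → toEhrhart-injective {π} {η} }
    ; surjective = λ P → fromEhrhart P , λ {π} π≈ →
        E.trans {toEhrhart π} {toEhrhart (fromEhrhart P)} {P}
          (toEhrhart-cong {π} {fromEhrhart P} π≈) (toEhrhart-fromEhrhart P) }

  deg⇔level : ∀ π k → deg π ≈ fromℤ (+ k) ⇔ level (toEhrhart π) ≡ k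
  deg⇔level π k = mk⇔
    (λ deg≈ → ℤ.+-injective (fromℤ-injective (Real.trans (toEhrhart-deg π) deg≈)))
    (λ level≡ → Real.trans (Real.sym (toEhrhart-deg π))
      (Real.reflexive (≡.cong (fromℤ ∘ +_) level≡)))

proposition4p4 :
    (n : ℕ) → .{{_ : NonZero n}} →
    (b : Vector ℕ n) (b≢0 : ∀ j → NonZero (b j)) →
    let open LSPaths b b≢0 in
    Σ[ f ∈ (LSPath → EhrhartPoint) ]
      (∀ π → (∀ i → fromℤ (point (f π) i) ≈ φ (coord π) i)
           × fromℤ (+ level (f π)) ≈ deg π)
      × IsGradedAlgebraIsomorphism semigroupAlgebra ehrhartRing (linearExtension f)
proposition4p4 n b b≢0 =
  toEhrhart b b≢0 ,
  (λ π → toEhrhart-φ b b≢0 π , toEhrhart-deg b b≢0 π) ,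
  linearExtension-isGradedAlgebraIsomorphism
    LSPath-monoid EhrhartPoint-monoid (toEhrhart-isMonoidIsomorphism b b≢0)
    (λ {k} {P} {Q} P≈Q level≡k → ≡.trans (≡.sym (proj₂ P≈Q)) level≡k)
    (deg⇔level b b≢0)
  where open LSPaths b b≢0
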